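{- For every integer $r\geq 3$ there exist constants $c_1,c_2$ depending only on $r$ such that for every integer $k\geq 1$ the following holds: if $G$ is an $n$-vertex linear $r$-graph with average degree $d(G)\geq c_1 k$, then $G$ contains linear cycles of $k$ consecutive lengths, the shortest of which has length at most $$6\left\lceil\frac{\log n}{\log (d(G)/k)-c_2}\right\rceil+6 .$$
   Context: All hypergraphs are finite. An $r$-graph is an $r$-uniform hypergraph; it is linear if any two distinct edges share at most one vertex. An $r$-uniform linear cycle of length $\ell\ge 3$ is an $r$-graph consisting of $\ell$ edges $e_1,\dots,e_\ell$ on $(r-1)\ell$ vertices such that $|e_i\cap e_j|=1$ if $j=i\pm 1$ (indices modulo $\ell$) and $|e_i\cap e_j|=0$ for all other $i\ne j$. The average degree $d(G)$ of an $n$-vertex $r$-graph is $r\,e(G)/n$, where $e(G)$ is the number of edges. "Linear cycles of $k$ consecutive lengths" means linear cycles of lengths $a,a+1,\dots,a+k-1$ for some integer $a$. Logarithms are base $2$. -}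

module Defs where

open import Data.Fin.Base using (Fin; toℕ)
open import Data.Fin.Properties using (nonZeroIndex)
open import Data.Fin.Subset using (Subset; ∣_∣; _∩_; ⋃)
open import Data.Integer.Base as ℤ using (ℤ; +_; -[1+_]; 1ℤ)
open import Data.List.Base using (List; length; tabulate)
open import Data.List.Membership.Propositional using (_∈_)
open import Data.List.Relation.Unary.Unique.Propositional using (Unique)
open import Data.Nat.Base as ℕ using (ℕ; suc; NonZero; _%_)
open import Data.Product.Base using (Σ; ∃; ∃-syntax; _×_)
open import Data.Rational.Unnormalised.Base as ℚᵘ
  using (ℚᵘ; _<_; _≤_; _+_; _*_; _/_; 0ℚᵘ; ½; ↥_; ↧ₙ_; +-*-rawSemiring)
open import Data.Sum.Base using (_⊎_)
open import Relation.Binary.PropositionalEquality using (_≡_; _≢_)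
open import Relation.Nullary using (¬_)

open import Algebra.Definitions.RawSemiring +-*-rawSemiring using (_^_)

------------------------------------------------------------------------
-- Hypergraphs

record RGraph (r n : ℕ) : Set where
  field
    edges   : List (Subset n)
    unique  : Unique edges
    uniform : ∀ {e} → e ∈ edges → ∣ e ∣ ≡ r

open RGraph public

Linear : ∀ {r n} → RGraph r n → Set
Linear G = ∀ {e f} → e ∈ edges G → f ∈ edges G → e ≢ f → ∣ e ∩ f ∣ ℕ.≤ 1

avgDegree : ∀ {r n} .{{_ : NonZero n}} → RGraph r n → ℚᵘ
avgDegree {r} {n} G = + (r ℕ.* length (edges G)) / n

CyclicSuc : ∀ {ℓ} → Fin ℓ → Fin ℓ → Set
CyclicSuc {ℓ} i j = toℕ j ≡ (suc (toℕ i) % ℓ) {{nonZeroIndex i}}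

Adjacent : ∀ {ℓ} → Fin ℓ → Fin ℓ → Set
Adjacent i j = CyclicSuc i j ⊎ CyclicSuc j i

-- The vertex count is an independent condition only for ℓ = 3, where it
-- excludes three edges through one common vertex.
record IsLinearCycle (r : ℕ) {n} (ℓ : ℕ) (e : Fin ℓ → Subset n) : Set where
  field
    length≥3    : 3 ℕ.≤ ℓ
    uniform     : ∀ i → ∣ e i ∣ ≡ r
    vertices    : ∣ ⋃ (tabulate e) ∣ ≡ (r ℕ.∸ 1) ℕ.* ℓ
    adjacent    : ∀ i j → Adjacent i j → ∣ e i ∩ e j ∣ ≡ 1
    nonadjacent : ∀ i j → i ≢ j → ¬ Adjacent i j → ∣ e i ∩ e j ∣ ≡ 0

ContainsLinearCycle : ∀ {r n} → RGraph r n → ℕ → Set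
ContainsLinearCycle {r} {n} G ℓ =
  Σ (Fin ℓ → Subset n) λ e → IsLinearCycle r ℓ e × (∀ i → e i ∈ edges G)

------------------------------------------------------------------------
-- Real numbers, as the sets of rationals strictly below and strictly
-- above them.  The cut axioms are not part of the record; every cut used
-- is built by the operations below.

record Cut : Set₁ where
  field
    lower : ℚᵘ → Set
    upper : ℚᵘ → Set

open Cut public

fromℚ : ℚᵘ → Cut
fromℚ c .lower q = q < c
fromℚ c .upper q = c < q

2^_ : ℤ → ℚᵘ
2^ (+ a)    = (+ 2 / 1) ^ a
2^ -[1+ a ] = ½ ^ suc a

-- Base 2, for x > 0.  With q = a / b and b > 0, q < log₂ x means
-- 2 ^ a < x ^ b.  At x = 0 this gives −∞: no rational is below.
log₂ : ℚᵘ → Cut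
log₂ x .lower q = 2^ (↥ q) < x ^ (↧ₙ q)
log₂ x .upper q = x ^ (↧ₙ q) < 2^ (↥ q)

infixl 6 _-_

_-_ : Cut → Cut → Cut
(x - y) .lower q = ∃[ a ] ∃[ b ] lower x a × upper y b × q + b ≤ a
(x - y) .upper q = ∃[ a ] ∃[ b ] upper x a × lower y b × a ≤ q + b

Positive : Cut → Set
Positive x = lower x 0ℚᵘ

infixl 7 _÷_[_]

-- For y > 0, q < x / y means q * y < x.  Since q may have either sign, q * y
-- is bounded above by the larger of q * b and q * b′ where b < y < b′.
_÷_[_] : (x y : Cut) → Positive y → Cut
(x ÷ y [ _ ]) .lower q =
  ∃[ a ] ∃[ b ] ∃[ b′ ]
    lower x a × lower y b × upper y b′ × q * b ≤ a × q * b′ ≤ a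
(x ÷ y [ _ ]) .upper q =
  ∃[ a ] ∃[ b ] ∃[ b′ ]
    upper x a × lower y b × upper y b′ × a ≤ q * b × a ≤ q * b′

-- m ≡⌈ x ⌉ : m - 1 < x ≤ m
_≡⌈_⌉ : ℤ → Cut → Set
m ≡⌈ x ⌉ = lower x ((m ℤ.- 1ℤ) / 1) × ¬ lower x (m / 1)

{-# OPTIONS --safe #-}
-- After deleting vertices of low degree, G has minimum degree above δ₀ ≈ d / r.  Explore the balls around a
-- vertex x.  If for every l < 2m the edges first met from level l number at most D times the vertices on
-- levels l and l + 1, then the balls grow by a factor δ₀ / 2rD at each step and outgrow n.  So one layer is
-- dense.  A random subset of its vertices keeps a constant fraction of its edges and makes the shortest path
-- from each surviving vertex to x meet the surviving edges in its first vertex only; call the result a spot.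
--
-- Find a spot S₁ in G, of minimum degree δ₁ ≈ √(δ₀ r k), and a spot S₂ inside S₁, of minimum degree r k, whose
-- balls are centred at a vertex b of S₁.  As r ≥ 3, the edges of S₂ can be assumed to have two vertices on one
-- and the same level λ.  Hence from a vertex z one can greedily grow a linear path of k edges in S₂, each edge
-- of which is left at a vertex of level λ.  Its initial segments, continued by shortest paths to b, are linear
-- paths from z to b inside S₁, of lengths λ + 1, …, λ + k.  A single path from z to b through x, which meets S₁
-- in z and b only, closes all of them to linear cycles, the shortest of which has length at most 3 · 2m + 1.
module Submission where

-- Closing the greedy path through a single centre fails: the paths from its two ends to the centre
-- may meet early, and cutting them short changes the length in an uncontrolled way. With nested
-- spots the varying part is exact, since a private path from level λ has length λ and meets S₂ in
-- its first vertex only. The outer part is one fixed path for all k cycles, so it may be shortened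
-- at will and only needs a bound. The geometric mean δ₁ divides the loss evenly. A ball of radius
-- 2m outgrows n once the ratio of two successive minimum degrees exceeds n^(1/2m) up to a constant,
-- and the two ratios multiply to n^(1/m). So d / k ≥ C n^(1/m) suffices, whence m ≈ log n / log (d
-- / Ck). Privacy is a local matter: outside its first two edges, a geodesic from a vertex of the
-- dense layer runs below level l, where the spot has no vertex. So the number of vertices on which
-- the random subset must be right for one edge depends on r only.

module Combinatorics where

  open import Data.Bool.Base using (Bool; true; false)
  import Data.Bool.Properties as Bool
  open import Data.Fin.Base as Fin using (Fin; zero; suc; toℕ)
  import Data.Fin.Properties as Fin
  open import Data.Fin.Subset
    using (Subset; _∈_; _∉_; _⊆_; ∣_∣; _∩_; _∪_; _─_; _-_; ⋃; ⁅_⁆; ⊥; ⊤; Nonempty)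
  open import Data.Fin.Subset.Properties using
    ( _∈?_; _⊆?_; nonempty?; ∉⊥; ∈⊤; ∣⊥∣≡0; ∣⁅x⁆∣≡1; ∣p∣≤n; x∈⁅x⁆; x∈⁅y⁆⇒x≡y; p⊆q⇒∣p∣≤∣q∣; ⊆-antisym; Empty-unique
    ; x∈p∩q⁺; x∈p∩q⁻; ∩-comm; x∈p∪q⁺; x∈p∪q⁻; x∈p⇒∣p-x∣<∣p∣; x∈p∧x≢y⇒x∈p-y; x∈p∧x∉q⇒x∈p─q; p─q⊆p)
  open import Data.List.Base using (List; []; _∷_; _++_; length; filter; allFin; tabulate; lookup; reverse)
  open import Data.List.Membership.Propositional using (find; lose) renaming (_∈_ to _∈ₗ_)
  open import Data.List.Membership.Propositional.Properties using (∈-filter⁻; ∈-++⁻; ∈-lookup; ∈-allFin)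
  import Data.List.Properties as List
  import Data.List.Relation.Unary.All as All
  open import Data.List.Relation.Unary.AllPairs using ([]; _∷_)
  open import Data.List.Relation.Unary.Any using (Any; here; there; any?)
  open import Data.List.Relation.Unary.Any.Properties using (reverse⁻)
  open import Data.List.Relation.Unary.Unique.Propositional using (Unique)
  open import Data.List.Relation.Unary.Unique.Propositional.Properties using () renaming (filter⁺ to unique-filter)
  open import Data.Nat.Base hiding (∣_-_∣)
  open import Data.Nat.DivMod using (m≡m%n+[m/n]*n; m%n<n; m/n*n≤m; m<n⇒m%n≡m; n%n≡0)
  open import Data.Nat.Properties
  open import Data.Nat.Solver using (module +-*-Solver)
  open import Data.Product.Base using (Σ-syntax; ∃-syntax; _×_; _,_; proj₁; proj₂)
  open import Data.Sum.Base using (_⊎_; inj₁; inj₂; [_,_]′)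
  open import Data.Vec.Base as Vec using ([]; _∷_)
  import Data.Vec.Properties as Vec
  open import Function.Base using (_∘_; id; case_of_)
  open import Relation.Binary.Definitions using (tri<; tri≈; tri>)
  open import Relation.Binary.PropositionalEquality
  open import Relation.Nullary using (¬_; Dec; yes; no; does; contradiction; _×-dec_; _⊎-dec_; ¬?)
  open import Relation.Nullary.Decidable using (dec-true)
  open import Relation.Unary using (Decidable)

  open import Algebra.Properties.CommutativeSemigroup +-commutativeSemigroup using (interchange)
  open import Defs using (RGraph; Linear; edges; CyclicSuc; Adjacent; IsLinearCycle; ContainsLinearCycle)

  private variable
    A B : Set
    n : ℕ
    a b c : Fin n
    es fs : List (Subset n)

  -- Double counting and minimum degree

  ∑ : List A → (A → ℕ) → ℕ
  ∑ []       g = 0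
  ∑ (x ∷ xs) g = g x + ∑ xs g

  ∑-mono : ∀ (xs : List A) {g h : A → ℕ} → (∀ {x} → x ∈ₗ xs → g x ≤ h x) → ∑ xs g ≤ ∑ xs h
  ∑-mono []       le = z≤n
  ∑-mono (x ∷ xs) le = +-mono-≤ (le (here refl)) (∑-mono xs (le ∘ there))

  ∑-cong : ∀ (xs : List A) {g h : A → ℕ} → (∀ x → g x ≡ h x) → ∑ xs g ≡ ∑ xs h
  ∑-cong []       eq = refl
  ∑-cong (x ∷ xs) eq = cong₂ _+_ (eq x) (∑-cong xs eq)

  ∑-0 : ∀ (xs : List A) → ∑ xs (λ _ → 0) ≡ 0
  ∑-0 []       = refl
  ∑-0 (x ∷ xs) = ∑-0 xs

  ∑-+ : ∀ (xs : List A) (g h : A → ℕ) → ∑ xs (λ x → g x + h x) ≡ ∑ xs g + ∑ xs h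
  ∑-+ []       g h = refl
  ∑-+ (x ∷ xs) g h = begin
    g x + h x + ∑ xs (λ x → g x + h x)  ≡⟨ cong (g x + h x +_) (∑-+ xs g h) ⟩
    g x + h x + (∑ xs g + ∑ xs h)       ≡⟨ interchange (g x) (h x) (∑ xs g) (∑ xs h) ⟩
    g x + ∑ xs g + (h x + ∑ xs h)       ∎
    where open ≡-Reasoning

  ∑-swap : ∀ (xs : List A) (ys : List B) (g : A → B → ℕ) →
           ∑ xs (λ x → ∑ ys (g x)) ≡ ∑ ys (λ y → ∑ xs (λ x → g x y))
  ∑-swap []       ys g = sym (∑-0 ys)
  ∑-swap (x ∷ xs) ys g =
    trans (cong (∑ ys (g x) +_) (∑-swap xs ys g)) (sym (∑-+ ys (g x) _))

  ∑-*ˡ : ∀ (xs : List A) (c : ℕ) (g : A → ℕ) → ∑ xs (λ x → c * g x) ≡ c * ∑ xs g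
  ∑-*ˡ []       c g = sym (*-zeroʳ c)
  ∑-*ˡ (x ∷ xs) c g = trans (cong (c * g x +_) (∑-*ˡ xs c g)) (sym (*-distribˡ-+ c (g x) (∑ xs g)))

  ∑-∈ : ∀ {x} {xs : List A} (g : A → ℕ) → x ∈ₗ xs → g x ≤ ∑ xs g
  ∑-∈ g (here refl) = m≤m+n _ _
  ∑-∈ g (there x∈)  = ≤-trans (∑-∈ g x∈) (m≤n+m _ _)

  ∑-tabulate : ∀ {n} (f : Fin n → A) (g : A → ℕ) → ∑ (tabulate f) g ≡ ∑ (allFin n) (g ∘ f)
  ∑-tabulate {n = zero}  f g = refl
  ∑-tabulate {n = suc n} f g = cong (g (f zero) +_)
    (trans (∑-tabulate (f ∘ suc) g) (sym (∑-tabulate Fin.suc (g ∘ f))))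

  𝟙 : {P : Set} → Dec P → ℕ
  𝟙 (yes _) = 1
  𝟙 (no  _) = 0

  𝟙-yes : {P : Set} (p : Dec P) → P → 𝟙 p ≡ 1
  𝟙-yes (yes _) _ = refl
  𝟙-yes (no ¬p) p = contradiction p ¬p

  𝟙-no : {P : Set} (p : Dec P) → ¬ P → 𝟙 p ≡ 0
  𝟙-no (yes p) ¬p = contradiction p ¬p
  𝟙-no (no _)  _  = refl

  𝟙≤ : {P : Set} (p : Dec P) {m : ℕ} → (P → 1 ≤ m) → 𝟙 p ≤ m
  𝟙≤ (yes p) f = f p
  𝟙≤ (no _)  f = z≤n

  𝟙-mono : {P Q : Set} (p : Dec P) (q : Dec Q) → (P → Q) → 𝟙 p ≤ 𝟙 q
  𝟙-mono p q f = 𝟙≤ p (λ x → ≤-reflexive (sym (𝟙-yes q (f x))))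

  # : {P : A → Set} → Decidable P → List A → ℕ
  # P? xs = ∑ xs (λ x → 𝟙 (P? x))

  #-mono : {P Q : A → Set} (P? : Decidable P) (Q? : Decidable Q) (xs : List A) →
           (∀ {x} → x ∈ₗ xs → P x → Q x) → # P? xs ≤ # Q? xs
  #-mono P? Q? xs f = ∑-mono xs (λ {x} x∈ → 𝟙-mono (P? x) (Q? x) (f x∈))

  #-filter : {P : A → Set} (P? : Decidable P) (xs : List A) → length (filter P? xs) ≡ # P? xs
  #-filter P? []       = refl
  #-filter P? (x ∷ xs) with P? x
  ... | yes _ = cong suc (#-filter P? xs)
  ... | no  _ = #-filter P? xs

  #-∁ : {P : A → Set} (P? : Decidable P) (xs : List A) → # P? xs + # (¬? ∘ P?) xs ≡ length xs
  #-∁ P? []       = refl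
  #-∁ P? (x ∷ xs) with P? x
  ... | yes _ = cong suc (#-∁ P? xs)
  ... | no  _ = trans (+-suc _ _) (cong suc (#-∁ P? xs))

  #-none : {P : A → Set} (P? : Decidable P) (xs : List A) → (∀ {x} → x ∈ₗ xs → ¬ P x) → # P? xs ≡ 0
  #-none P? []       f = refl
  #-none P? (x ∷ xs) f = cong₂ _+_ (𝟙-no (P? x) (f (here refl))) (#-none P? xs (f ∘ there))

  #-all : {P : A → Set} (P? : Decidable P) (xs : List A) → (∀ {x} → x ∈ₗ xs → P x) → # P? xs ≡ length xs
  #-all P? []       f = refl
  #-all P? (x ∷ xs) f = cong₂ _+_ (𝟙-yes (P? x) (f (here refl))) (#-all P? xs (f ∘ there))

  #-unique : {P : A → Set} (P? : Decidable P) {xs : List A} → Unique xs →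
             (∀ {x y} → x ∈ₗ xs → y ∈ₗ xs → P x → P y → x ≡ y) → # P? xs ≤ 1
  #-unique P? []              eq = z≤n
  #-unique P? {x ∷ xs} (x∉ ∷ u) eq with P? x
  ... | no  _ = #-unique P? u (λ y∈ z∈ → eq (there y∈) (there z∈))
  ... | yes p = ≤-reflexive (cong suc (#-none P? xs λ y∈ q →
                  contradiction (eq (here refl) (there y∈) p q) (All.lookup x∉ y∈)))

  #-∃ : {P : A → Set} (P? : Decidable P) (xs : List A) → 0 < # P? xs → ∃[ x ] x ∈ₗ xs × P x
  #-∃ P? (x ∷ xs) lt with P? x
  ... | yes p = x , here refl , p
  ... | no  _ with #-∃ P? xs lt
  ...   | y , y∈ , q = y , there y∈ , q

  ⟪_⟫ : {P : Fin n → Set} → Decidable P → Subset n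
  ⟪ P? ⟫ = Vec.tabulate (does ∘ P?)

  ∈⟪⟫⁺ : {P : Fin n → Set} (P? : Decidable P) {x : Fin n} → P x → x ∈ ⟪ P? ⟫
  ∈⟪⟫⁺ P? {x} p = Vec.lookup⇒[]= x _ (trans (Vec.lookup∘tabulate _ x) (dec-true (P? x) p))

  ∈⟪⟫⁻ : {P : Fin n → Set} (P? : Decidable P) {x : Fin n} → x ∈ ⟪ P? ⟫ → P x
  ∈⟪⟫⁻ P? {x} x∈ = does-true (P? x) (trans (sym (Vec.lookup∘tabulate (does ∘ P?) x)) (Vec.[]=⇒lookup x∈))
    where
    does-true : {P : Set} (p : Dec P) → does p ≡ true → P
    does-true (yes p) _ = p

  ∣∣≡# : (p : Subset n) → ∣ p ∣ ≡ # (_∈? p) (allFin n)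
  ∣∣≡# []          = refl
  ∣∣≡# {suc n} (true  ∷ p) = cong suc (trans (∣∣≡# p) (trans (∑-cong (allFin n) shift) (sym (∑-tabulate Fin.suc (λ x → 𝟙 (x ∈? (true ∷ p)))))))
    where
    shift : ∀ x → 𝟙 (x ∈? p) ≡ 𝟙 (suc x ∈? (true ∷ p))
    shift x with x ∈? p
    ... | yes _ = refl
    ... | no _  = refl
  ∣∣≡# {suc n} (false ∷ p) = trans (∣∣≡# p) (trans (∑-cong (allFin n) shift) (sym (∑-tabulate Fin.suc (λ x → 𝟙 (x ∈? (false ∷ p))))))
    where
    shift : ∀ x → 𝟙 (x ∈? p) ≡ 𝟙 (suc x ∈? (false ∷ p))
    shift x with x ∈? p
    ... | yes _ = refl
    ... | no _  = refl

  ∣∣-∃ : (p : Subset n) → 0 < ∣ p ∣ → Nonempty p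
  ∣∣-∃ p lt with #-∃ (_∈? p) (allFin _) (subst (0 <_) (∣∣≡# p) lt)
  ... | x , _ , x∈ = x , x∈

  ∣∪∣≤ : (p q : Subset n) → ∣ p ∪ q ∣ ≤ ∣ p ∣ + ∣ q ∣
  ∣∪∣≤ {n} p q = begin
    ∣ p ∪ q ∣                                    ≡⟨ ∣∣≡# (p ∪ q) ⟩
    # (_∈? p ∪ q) (allFin n)                     ≤⟨ ∑-mono (allFin n) (λ {x} _ → 𝟙≤ (x ∈? p ∪ q) (bound x)) ⟩
    ∑ (allFin n) (λ x → 𝟙 (x ∈? p) + 𝟙 (x ∈? q)) ≡⟨ ∑-+ (allFin n) _ _ ⟩
    # (_∈? p) (allFin n) + # (_∈? q) (allFin n)  ≡⟨ cong₂ _+_ (∣∣≡# p) (∣∣≡# q) ⟨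
    ∣ p ∣ + ∣ q ∣                                ∎
    where
    open ≤-Reasoning
    bound : ∀ x → x ∈ p ∪ q → 1 ≤ 𝟙 (x ∈? p) + 𝟙 (x ∈? q)
    bound x x∈ with x∈p∪q⁻ p q x∈
    ... | inj₁ h = ≤-trans (≤-reflexive (sym (𝟙-yes (x ∈? p) h))) (m≤m+n _ _)
    ... | inj₂ h = ≤-trans (≤-reflexive (sym (𝟙-yes (x ∈? q) h))) (m≤n+m _ _)

  ∣∪∣-disjoint : (p q : Subset n) → (∀ {x} → x ∈ p → x ∉ q) → ∣ p ∣ + ∣ q ∣ ≤ ∣ p ∪ q ∣
  ∣∪∣-disjoint {n} p q dis = begin
    ∣ p ∣ + ∣ q ∣                                ≡⟨ cong₂ _+_ (∣∣≡# p) (∣∣≡# q) ⟩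
    # (_∈? p) (allFin n) + # (_∈? q) (allFin n)  ≡⟨ ∑-+ (allFin n) _ _ ⟨
    ∑ (allFin n) (λ x → 𝟙 (x ∈? p) + 𝟙 (x ∈? q)) ≤⟨ ∑-mono (allFin n) (λ {x} _ → bound x) ⟩
    # (_∈? p ∪ q) (allFin n)                     ≡⟨ ∣∣≡# (p ∪ q) ⟨
    ∣ p ∪ q ∣                                    ∎
    where
    open ≤-Reasoning
    bound : ∀ x → 𝟙 (x ∈? p) + 𝟙 (x ∈? q) ≤ 𝟙 (x ∈? p ∪ q)
    bound x with x ∈? p
    ... | yes h = ≤-reflexive (trans (cong suc (𝟙-no (x ∈? q) (dis h)))
                    (sym (𝟙-yes (x ∈? p ∪ q) (x∈p∪q⁺ (inj₁ h)))))
    ... | no _  = 𝟙-mono (x ∈? q) (x ∈? p ∪ q) (λ h → x∈p∪q⁺ (inj₂ h))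

  Lin : List (Subset n) → Set
  Lin E = ∀ {e f} → e ∈ₗ E → f ∈ₗ E → ∀ {x y} → x ≢ y → x ∈ e → y ∈ e → x ∈ f → y ∈ f → e ≡ f

  deg : List (Subset n) → Fin n → ℕ
  deg E v = # (v ∈?_) E

  infix 4 _∼?_
  _∼?_ : (e U : Subset n) → Dec (Nonempty (e ∩ U))
  e ∼? U = nonempty? (e ∩ U)

  handshake : ∀ (E : List (Subset n)) (U : Subset n) →
              ∑ (allFin n) (λ v → 𝟙 (v ∈? U) * deg E v) ≡ ∑ E (λ e → ∣ e ∩ U ∣)
  handshake {n} E U = begin
    ∑ (allFin n) (λ v → 𝟙 (v ∈? U) * deg E v)                       ≡⟨ ∑-cong (allFin n) (λ v → sym (∑-*ˡ E (𝟙 (v ∈? U)) _)) ⟩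
    ∑ (allFin n) (λ v → ∑ E (λ e → 𝟙 (v ∈? U) * 𝟙 (v ∈? e)))         ≡⟨ ∑-swap (allFin n) E _ ⟩
    ∑ E (λ e → ∑ (allFin n) (λ v → 𝟙 (v ∈? U) * 𝟙 (v ∈? e)))         ≡⟨ ∑-cong E (λ e → ∑-cong (allFin n) (λ v → both e v)) ⟩
    ∑ E (λ e → # (_∈? e ∩ U) (allFin n))                              ≡⟨ ∑-cong E (λ e → ∣∣≡# (e ∩ U)) ⟨
    ∑ E (λ e → ∣ e ∩ U ∣)                                             ∎
    where
    open ≡-Reasoning
    both : ∀ e v → 𝟙 (v ∈? U) * 𝟙 (v ∈? e) ≡ 𝟙 (v ∈? e ∩ U)
    both e v with v ∈? U | v ∈? e
    ... | yes a | yes b = sym (𝟙-yes (v ∈? e ∩ U) (x∈p∩q⁺ (b , a)))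
    ... | yes a | no ¬b = sym (𝟙-no (v ∈? e ∩ U) (¬b ∘ proj₁ ∘ x∈p∩q⁻ e U))
    ... | no ¬a | _     = sym (𝟙-no (v ∈? e ∩ U) (¬a ∘ proj₂ ∘ x∈p∩q⁻ e U))

  -- Each such edge is charged to a vertex `y` of `Y` on it. As `y` differs from `v`, linearity
  -- allows only one edge through both, so no `y` is charged twice.
  meeting≤ : ∀ {E : List (Subset n)} → Unique E → Lin E → ∀ {v} Y → v ∉ Y →
        # (λ f → (v ∈? f) ×-dec (f ∼? Y)) E ≤ ∣ Y ∣
  meeting≤ {n} {E} u lin {v} Y v∉Y = begin
    # (λ f → (v ∈? f) ×-dec (f ∼? Y)) E                    ≤⟨ ∑-mono E (λ {f} _ → 𝟙≤ _ (meet f)) ⟩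
    ∑ E (λ f → ∑ (allFin n) (λ y → 𝟙 (t? y f)))            ≡⟨ ∑-swap E (allFin n) _ ⟩
    ∑ (allFin n) (λ y → # (t? y) E)                        ≤⟨ ∑-mono (allFin n) (λ {y} _ → atMostOne y (y ∈? Y)) ⟩
    # (_∈? Y) (allFin n)                                   ≡⟨ ∣∣≡# Y ⟨
    ∣ Y ∣                                                  ∎
    where
    open ≤-Reasoning
    t? : ∀ y f → Dec (y ∈ Y × (v ∈ f × y ∈ f))
    t? y f = (y ∈? Y) ×-dec ((v ∈? f) ×-dec (y ∈? f))
    meet : ∀ f → v ∈ f × Nonempty (f ∩ Y) → 1 ≤ ∑ (allFin n) (λ y → 𝟙 (t? y f))
    meet f (v∈f , y , y∈) with x∈p∩q⁻ f Y y∈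
    ... | y∈f , y∈Y = ≤-trans (≤-reflexive (sym (𝟙-yes (t? y f) (y∈Y , v∈f , y∈f)))) (∑-∈ (λ y → 𝟙 (t? y f)) (∈-allFin y))
    atMostOne : ∀ y (d : Dec (y ∈ Y)) → # (t? y) E ≤ 𝟙 d
    atMostOne y (no y∉)  = ≤-reflexive (#-none (t? y) E λ _ t → y∉ (proj₁ t))
    atMostOne y (yes y∈) = #-unique (t? y) u λ e∈ f∈ (_ , v∈e , y∈e) (_ , v∈f , y∈f) →
          lin e∈ f∈ (λ { refl → v∉Y y∈ }) v∈e y∈e v∈f y∈f

  -- Deleting a vertex of degree ≤ δ keeps the edge count above δ times the number of vertices left.
  abstract
    minDegree : ∀ δ {E : List (Subset n)} (W : Subset n) → Unique E →
                (∀ {e} → e ∈ₗ E → e ⊆ W) → δ * ∣ W ∣ < length E →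
                ∃[ F ] Unique F × (∀ {f} → f ∈ₗ F → f ∈ₗ E) × (∃[ f ] f ∈ₗ F)
                  × (∀ {f v} → f ∈ₗ F → v ∈ f → δ < deg F v)
    minDegree {n} δ W = go (∣ W ∣) W ≤-refl
      where
      -- `N` bounds the vertices left and ensures termination. Strictness of the density keeps the
      -- edge list nonempty throughout.
      go : ∀ N {E : List (Subset n)} (W : Subset n) → ∣ W ∣ ≤ N → Unique E →
           (∀ {e} → e ∈ₗ E → e ⊆ W) → δ * ∣ W ∣ < length E →
           ∃[ F ] Unique F × (∀ {f} → f ∈ₗ F → f ∈ₗ E) × (∃[ f ] f ∈ₗ F)
             × (∀ {f v} → f ∈ₗ F → v ∈ f → δ < deg F v)
      go N {E} W W≤N u E⊆W dense with Fin.any? (λ v → (v ∈? W) ×-dec (deg E v ≤? δ))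
      ... | no ∄ = E , u , id , nonempty E dense , λ f∈ v∈ → ≰⇒> (λ le → ∄ (_ , E⊆W f∈ v∈ , le))
        where
        nonempty : ∀ {m} (E : List (Subset n)) → m < length E → ∃[ f ] f ∈ₗ E
        nonempty (f ∷ _) _ = f , here refl
      go zero W W≤N u E⊆W dense | yes (v , v∈W , low) =
        contradiction (≤-trans (x∈p⇒∣p-x∣<∣p∣ v∈W) W≤N) λ ()
      go (suc N) {E} W W≤N u E⊆W dense | yes (v , v∈W , low)
        with go N (W - v) (s≤s⁻¹ (≤-trans (x∈p⇒∣p-x∣<∣p∣ v∈W) W≤N))
                (unique-filter away? u) sub dense′
        where
        open import Data.Fin.Subset using (_-_)
        away? : Decidable (λ e → v ∉ e)
        away? e = ¬? (v ∈? e)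
        sub : ∀ {e} → e ∈ₗ filter away? E → e ⊆ W - v
        sub e∈ x∈ with ∈-filter⁻ away? {xs = E} e∈
        ... | e∈E , v∉ = x∈p∧x≢y⇒x∈p-y (E⊆W e∈E x∈) (λ { refl → v∉ x∈ })
        dense′ : δ * ∣ W - v ∣ < length (filter away? E)
        dense′ = +-cancelˡ-< δ _ _ (begin-strict
          δ + δ * ∣ W - v ∣               ≡⟨ *-suc δ ∣ W - v ∣ ⟨
          δ * suc ∣ W - v ∣               ≤⟨ *-monoʳ-≤ δ (x∈p⇒∣p-x∣<∣p∣ v∈W) ⟩
          δ * ∣ W ∣                       <⟨ dense ⟩
          length E                        ≡⟨ #-∁ (v ∈?_) E ⟨
          deg E v + # away? E             ≤⟨ +-monoˡ-≤ _ low ⟩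
          δ + # away? E                   ≡⟨ cong (δ +_) (#-filter away? E) ⟨
          δ + length (filter away? E)     ∎)
          where open ≤-Reasoning
      ... | F , uF , F⊆ , ne , high = F , uF , (λ f∈ → proj₁ (∈-filter⁻ _ {xs = E} (F⊆ f∈))) , ne , high

  -- Separating pairs of sets by a single set

  -- weight A B C is 2 ^ (∣ A ∣ + ∣ B ∣) if C contains A and avoids B, and 0 otherwise (for disjoint A and B),
  -- so its average over all C is 1.
  headWeight : Bool → Bool → Bool → ℕ
  headWeight false false _     = 1
  headWeight true  true  _     = 1
  headWeight true  false true  = 2
  headWeight true  false false = 0
  headWeight false true  true  = 0
  headWeight false true  false = 2

  weight : Subset n → Subset n → Subset n → ℕ
  weight {zero}  A B C = 1
  weight {suc n} A B C = headWeight (Vec.head A) (Vec.head B) (Vec.head C) * weight (Vec.tail A) (Vec.tail B) (Vec.tail C)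

  headWeight-average : ∀ a b → headWeight a b true + headWeight a b false ≡ 2
  headWeight-average true  true  = refl
  headWeight-average true  false = refl
  headWeight-average false true  = refl
  headWeight-average false false = refl

  -- Method of conditional expectations: vertices are put into `C` or left out one at a time, always
  -- on the side where the weighted sum is no smaller. The factors of the vertices already decided
  -- are collected in `w`.
  aboveAverage : ∀ {n} {X : Set} (fs : List X) (A B : X → Subset n) (w : X → ℕ) →
                 ∃[ C ] ∑ fs w ≤ ∑ fs (λ f → w f * weight (A f) (B f) C)
  aboveAverage {zero}  fs A B w = [] , ≤-reflexive (∑-cong fs (λ f → sym (*-identityʳ (w f))))
  aboveAverage {suc n} fs A B w = [ extend false ∘ half false true total′ , extend true ∘ half true false total ]′
                                    (≤-total (∑ fs (w′ true)) (∑ fs (w′ false)))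
    where
    w′ : Bool → _ → ℕ
    w′ c f = w f * headWeight (Vec.head (A f)) (Vec.head (B f)) c
    total : ∑ fs (w′ true) + ∑ fs (w′ false) ≡ ∑ fs w + ∑ fs w
    total = begin
      ∑ fs (w′ true) + ∑ fs (w′ false)        ≡⟨ ∑-+ fs (w′ true) (w′ false) ⟨
      ∑ fs (λ f → w′ true f + w′ false f)     ≡⟨ ∑-cong fs (λ f → trans (sym (*-distribˡ-+ (w f) _ _))
                                                   (trans (cong (w f *_) (headWeight-average (Vec.head (A f)) (Vec.head (B f))))
                                                     (trans (*-comm (w f) 2) (cong (w f +_) (+-identityʳ (w f)))))) ⟩
      ∑ fs (λ f → w f + w f)                  ≡⟨ ∑-+ fs w w ⟩
      ∑ fs w + ∑ fs w                         ∎
      where open ≡-Reasoning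
    total′ : ∑ fs (w′ false) + ∑ fs (w′ true) ≡ ∑ fs w + ∑ fs w
    total′ = trans (+-comm (∑ fs (w′ false)) _) total
    half : ∀ c d → ∑ fs (w′ c) + ∑ fs (w′ d) ≡ ∑ fs w + ∑ fs w → ∑ fs (w′ d) ≤ ∑ fs (w′ c) → ∑ fs w ≤ ∑ fs (w′ c)
    half c d eq le = ≮⇒≥ λ lt → <-irrefl eq (+-mono-< lt (≤-<-trans le lt))
    extend : ∀ c → ∑ fs w ≤ ∑ fs (w′ c) → ∃[ C ] ∑ fs w ≤ ∑ fs (λ f → w f * weight (A f) (B f) C)
    extend c le with aboveAverage fs (Vec.tail ∘ A) (Vec.tail ∘ B) (w′ c)
    ... | C , le′ = c ∷ C , ≤-trans le (≤-trans le′ (≤-reflexive (∑-cong fs (λ f → *-assoc (w f) _ _))))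

  weight≤ : (A B C : Subset n) → weight A B C ≤ 2 ^ (∣ A ∣ + ∣ B ∣)
  weight≤ []          []          []      = ≤-refl
  weight≤ (true ∷ A)  (true ∷ B)  (c ∷ C) = ≤-trans (*-monoʳ-≤ 1 (weight≤ A B C))
    (≤-trans (≤-reflexive (*-identityˡ _)) (^-monoʳ-≤ 2 (≤-trans (+-monoʳ-≤ ∣ A ∣ (n≤1+n _)) (n≤1+n _))))
  weight≤ (true ∷ A)  (false ∷ B) (true ∷ C)  = *-monoʳ-≤ 2 (weight≤ A B C)
  weight≤ (true ∷ A)  (false ∷ B) (false ∷ C) = z≤n
  weight≤ (false ∷ A) (true ∷ B)  (true ∷ C)  = z≤n
  weight≤ (false ∷ A) (true ∷ B)  (false ∷ C) =
    ≤-trans (*-monoʳ-≤ 2 (weight≤ A B C)) (≤-reflexive (cong (2 ^_) (sym (+-suc ∣ A ∣ ∣ B ∣))))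
  weight≤ (false ∷ A) (false ∷ B) (c ∷ C) = ≤-trans (≤-reflexive (*-identityˡ _)) (weight≤ A B C)

  weight⇒⊆ : (A B C : Subset n) → (∀ {x} → x ∈ A → x ∉ B) → 0 < weight A B C → A ⊆ C
  weight⇒⊆ (true ∷ A) (true ∷ B)  (c ∷ C)     dis pos Vec.here = contradiction Vec.here (dis Vec.here)
  weight⇒⊆ (true ∷ A) (false ∷ B) (true ∷ C)  dis pos Vec.here = Vec.here
  weight⇒⊆ (a ∷ A)    (b ∷ B)     (c ∷ C)     dis pos (Vec.there x∈) =
    Vec.there (weight⇒⊆ A B C (λ x∈A x∈B → dis (Vec.there x∈A) (Vec.there x∈B))
      (n≢0⇒n>0 λ eq → <-irrefl (sym (trans (cong (headWeight a b c *_) eq) (*-zeroʳ (headWeight a b c)))) pos) x∈)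

  weight⇒∉ : (A B C : Subset n) → (∀ {x} → x ∈ A → x ∉ B) → 0 < weight A B C → ∀ {x} → x ∈ B → x ∉ C
  weight⇒∉ (true ∷ A)  (true ∷ B) (c ∷ C)    dis pos Vec.here = contradiction Vec.here (dis Vec.here)
  weight⇒∉ (false ∷ A) (true ∷ B) (true ∷ C) dis () Vec.here
  weight⇒∉ (false ∷ A) (true ∷ B) (false ∷ C) dis pos Vec.here = λ ()
  weight⇒∉ (a ∷ A)     (b ∷ B)    (c ∷ C)    dis pos (Vec.there x∈) (Vec.there x∈C) =
    weight⇒∉ A B C (λ x∈A x∈B → dis (Vec.there x∈A) (Vec.there x∈B))
      (n≢0⇒n>0 λ eq → <-irrefl (sym (trans (cong (headWeight a b c *_) eq) (*-zeroʳ (headWeight a b c)))) pos) x∈ x∈C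

  separates? : ∀ {X : Set} (A B : X → Subset n) (C : Subset n) → Decidable (λ f → A f ⊆ C × ¬ Nonempty (B f ∩ C))
  separates? A B C f = (A f ⊆? C) ×-dec ¬? (B f ∼? C)

  -- A random C separates each pair with probability at least 2 ^ - s.
  abstract
    separation : ∀ {X : Set} (fs : List X) (A B : X → Subset n) s →
                 (∀ {f} → f ∈ₗ fs → ∀ {x} → x ∈ A f → x ∉ B f) →
                 (∀ {f} → f ∈ₗ fs → ∣ A f ∣ + ∣ B f ∣ ≤ s) →
                 ∃[ C ] length fs ≤ 2 ^ s * # (separates? A B C) fs
    separation fs A B s dis small with aboveAverage fs A B (λ _ → 1)
    ... | C , le = C , (begin
      length fs                                            ≡⟨ ones fs ⟨
      ∑ fs (λ _ → 1)                                       ≤⟨ le ⟩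
      ∑ fs (λ f → 1 * weight (A f) (B f) C)                ≤⟨ ∑-mono fs (λ {f} f∈ → bound f f∈) ⟩
      ∑ fs (λ f → 2 ^ s * 𝟙 (separates? A B C f))          ≡⟨ ∑-*ˡ fs (2 ^ s) _ ⟩
      2 ^ s * # (separates? A B C) fs                      ∎)
      where
      open ≤-Reasoning
      ones : ∀ {X : Set} (fs : List X) → ∑ fs (λ _ → 1) ≡ length fs
      ones []       = refl
      ones (_ ∷ fs) = cong suc (ones fs)
      -- A weight is zero unless `C` separates the pair and at most `2 ^ s` if it does, so a total
      -- of `length fs` takes at least `length fs / 2 ^ s` separated pairs.
      bound : ∀ f → f ∈ₗ fs → 1 * weight (A f) (B f) C ≤ 2 ^ s * 𝟙 (separates? A B C f)
      bound f f∈ with 0 <? weight (A f) (B f) C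
      ... | no ¬pos = ≤-trans (≤-reflexive (trans (*-identityˡ _) (n≤0⇒n≡0 (≮⇒≥ ¬pos)))) z≤n
      ... | yes pos = begin
        1 * weight (A f) (B f) C                    ≡⟨ *-identityˡ _ ⟩
        weight (A f) (B f) C                        ≤⟨ weight≤ (A f) (B f) C ⟩
        2 ^ (∣ A f ∣ + ∣ B f ∣)                     ≤⟨ ^-monoʳ-≤ 2 (small f∈) ⟩
        2 ^ s                                       ≡⟨ *-identityʳ (2 ^ s) ⟨
        2 ^ s * 1                                   ≡⟨ cong (2 ^ s *_) (𝟙-yes (separates? A B C f)
                                                         (weight⇒⊆ (A f) (B f) C (dis f∈) pos ,
                                                          λ (x , x∈) → weight⇒∉ (A f) (B f) C (dis f∈) pos
                                                            (proj₁ (x∈p∩q⁻ (B f) C x∈)) (proj₂ (x∈p∩q⁻ (B f) C x∈)))) ⟨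
        2 ^ s * 𝟙 (separates? A B C f)              ∎

  -- Linear paths

  -- A linear path from a to b.  Since c lies in no edge of es but the first, an edge e in front
  -- meets the next edge in c only and is disjoint from the others.
  data Path {n} : Fin n → List (Subset n) → Fin n → Set where
    []   : Path a [] a
    cons : ∀ {e} → a ∈ e → c ∈ e → a ≢ c → (∀ {f x} → f ∈ₗ es → x ∈ e → x ∈ f → x ≡ c) →
           Path c es b → Path a (e ∷ es) b

  start-first : ∀ {e} → Path a (e ∷ es) b → ∀ {f} → f ∈ₗ es → a ∉ f
  start-first (cons a∈ _ a≢c only _) f∈ a∈f = a≢c (only f∈ a∈ a∈f)

  end-last : ∀ {e} → Path a (e ∷ es) b → ∃[ f ] f ∈ₗ (e ∷ es) × b ∈ f
  end-last (cons a∈ c∈ a≢c only [])              = _ , here refl , c∈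
  end-last (cons a∈ c∈ a≢c only p@(cons _ _ _ _ _)) with end-last p
  ... | f , f∈ , b∈ = f , there f∈ , b∈

  start≢end : ∀ {e} → Path a (e ∷ es) b → a ≢ b
  start≢end (cons a∈ c∈ a≢c only []) = a≢c
  start≢end p@(cons a∈ c∈ a≢c only q@(cons _ _ _ _ _)) refl with end-last q
  ... | f , f∈ , b∈ = start-first p f∈ b∈

  end-only-last : ∀ {e} → Path a (e ∷ es) b → b ∈ e → es ≡ []
  end-only-last (cons a∈ c∈ a≢c only []) b∈ = refl
  end-only-last (cons a∈ c∈ a≢c only q@(cons _ _ _ _ _)) b∈ with end-last q
  ... | f , f∈ , b∈f = contradiction (sym (only f∈ b∈ b∈f)) (start≢end q)

  empty-path : Path a es b → es ≡ [] → a ≡ b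
  empty-path [] _ = refl

  append : Path a es c → Path c fs b → (∀ {e f x} → e ∈ₗ es → f ∈ₗ fs → x ∈ e → x ∈ f → x ≡ c) →
           Path a (es ++ fs) b
  append [] q cross = q
  append {fs = fs} p@(cons {c = d} {es = es} {e = e} a∈ d∈ a≢d only p′) q cross =
    cons a∈ d∈ a≢d only′ (append p′ q (cross ∘ there))
    where
    only′ : ∀ {f x} → f ∈ₗ (es ++ fs) → x ∈ e → x ∈ f → x ≡ d
    only′ f∈ x∈e x∈f with ∈-++⁻ es f∈
    ... | inj₁ f∈es = only f∈es x∈e x∈f
    -- Here `e` contains the end `c` of the first path. Then `e` is its last edge, and `d` is `c`.
    ... | inj₂ f∈fs = trans x≡c (sym (empty-path p′ (end-only-last p (subst (_∈ e) x≡c x∈e))))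
      where x≡c = cross (here refl) f∈fs x∈e x∈f

  single : ∀ {e} → a ∈ e → b ∈ e → a ≢ b → Path a (e ∷ []) b
  single a∈ b∈ a≢b = cons a∈ b∈ a≢b (λ ()) []

  reverse-∈ : ∀ {e : Subset n} es → e ∈ₗ reverse es → e ∈ₗ es
  reverse-∈ es = reverse⁻

  reversePath : Path a es b → Path b (reverse es) a
  reversePath [] = []
  reversePath {n} {a = a} {b = b} (cons {c = c} {es = es} {e = e} a∈ c∈ a≢c only p) =
    subst (λ fs → Path b fs a) (sym (List.unfold-reverse e es))
      (append (reversePath p) (single c∈ a∈ (a≢c ∘ sym))
        λ { f∈ (here refl) x∈f x∈e → only (reverse-∈ es f∈) x∈e x∈f })

  start-avoids : ∀ {e} → Path a es b → b ∉ e → (∀ {f x} → f ∈ₗ es → x ∈ e → x ∉ f) → a ∉ e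
  start-avoids []                 b∉ away a∈e = b∉ a∈e
  start-avoids (cons a∈ _ _ _ _) b∉ away a∈e = away (here refl) a∈e a∈

  module _ {E : List (Subset n)} (lin : Lin E) where

    -- Putting `e` in front may create crossings. The recursion finds the last edge of the path that
    -- `e` meets and enters the path there, so all edges behind it are disjoint from `e`.
    reroute : ∀ {a e} → a ∈ e → e ∈ₗ E → Path c es b → (∀ {f} → f ∈ₗ es → f ∈ₗ E) →
              (b ∉ e × (∀ {f x} → f ∈ₗ es → x ∈ e → x ∉ f))
              ⊎ (∃[ fs ] Path a fs b × length fs ≤ suc (length es) × (∀ {f} → f ∈ₗ fs → f ≡ e ⊎ f ∈ₗ es))
    reroute {b = b} {a = a} {e} a∈ e∈ [] es⊆ with b ∈? e
    ... | no b∉ = inj₁ (b∉ , λ ())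
    ... | yes b∈ with a Fin.≟ b
    ...   | yes refl = inj₂ ([] , [] , z≤n , λ ())
    ...   | no a≢b = inj₂ (e ∷ [] , single a∈ b∈ a≢b , s≤s z≤n , λ { (here refl) → inj₁ refl })
    reroute {b = b} {a = a} {e} a∈ e∈ (cons {c = d} {es = es} {e = f} c∈ d∈ c≢d only p) es⊆
      with reroute a∈ e∈ p (es⊆ ∘ there)
    ... | inj₂ (fs , q , len , fs⊆) =
      inj₂ (fs , q , ≤-trans len (n≤1+n _) , λ g∈ → [ inj₁ , inj₂ ∘ there ]′ (fs⊆ g∈))
    ... | inj₁ (b∉ , away) with e ∼? f
    ...   | no ∄ = inj₁ (b∉ , λ { (here refl) x∈e x∈f → ∄ (_ , x∈p∩q⁺ (x∈e , x∈f)) ; (there g∈) → away g∈ })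
    ...   | yes (x , x∈) = inj₂ (enter (x∈p∩q⁻ e f x∈))
      where
      d∉ : d ∉ e
      d∉ = start-avoids p b∉ away
      from : ∀ {y} → y ∈ e → y ∈ f → Path y (f ∷ es) b
      from y∈e y∈f = cons y∈f d∈ (λ { refl → d∉ y∈e }) only p
      enter : x ∈ e × x ∈ f → ∃[ fs ] Path a fs b × length fs ≤ suc (length (f ∷ es)) × (∀ {g} → g ∈ₗ fs → g ≡ e ⊎ g ∈ₗ (f ∷ es))
      enter (x∈e , x∈f) with a Fin.≟ x
      ... | yes refl = f ∷ es , from a∈ x∈f , n≤1+n _ , inj₂
      ... | no a≢x = e ∷ f ∷ es , cons a∈ x∈e a≢x only′ (from x∈e x∈f) , ≤-refl ,
                     λ { (here refl) → inj₁ refl ; (there g∈) → inj₂ g∈ }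
        where
        only′ : ∀ {g y} → g ∈ₗ (f ∷ es) → y ∈ e → y ∈ g → y ≡ x
        only′ (there g∈) y∈e y∈g = contradiction y∈g (away g∈ y∈e)
        only′ {y = y} (here refl) y∈e y∈f with y Fin.≟ x
        ... | yes eq = eq
        -- A second common vertex would make `e` and `f` equal by linearity, but `d` lies on `f` and
        -- not on `e`.
        ... | no y≢x with refl ← lin e∈ (es⊆ (here refl)) y≢x y∈e x∈e y∈f x∈f = contradiction d∈ d∉

    -- The two paths may cross anywhere, so `append` does not apply. The edges of the first are put
    -- in front of the second from back to front by `reroute`; every crossing becomes a shortcut,
    -- which may bypass `c`.
    join : ∀ {a} → Path a es c → Path c fs b → (∀ {f} → f ∈ₗ es → f ∈ₗ E) → (∀ {f} → f ∈ₗ fs → f ∈ₗ E) →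
           ∃[ gs ] Path a gs b × length gs ≤ length es + length fs × (∀ {g} → g ∈ₗ gs → g ∈ₗ es ⊎ g ∈ₗ fs)
    join [] q es⊆ fs⊆ = _ , q , ≤-refl , inj₂
    join {fs = fs} (cons {c = d} {es = es} {e = e} a∈ d∈ a≢d only p) q es⊆ fs⊆ with join p q (es⊆ ∘ there) fs⊆
    ... | gs , r , len , gs⊆ with reroute a∈ (es⊆ (here refl)) r (λ g∈ → [ es⊆ ∘ there , fs⊆ ]′ (gs⊆ g∈))
    ...   | inj₂ (hs , s , len′ , hs⊆) = hs , s , ≤-trans len′ (s≤s len) ,
             λ h∈ → [ (λ { refl → inj₁ (here refl) }) , (λ g∈ → [ inj₁ ∘ there , inj₂ ]′ (gs⊆ g∈)) ]′ (hs⊆ h∈)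
    ...   | inj₁ (b∉ , away) = contradiction d∈ (start-avoids r b∉ away)

  -- Closing a linear path to a linear cycle

  ∣∣≡1 : {p : Subset n} {x : Fin n} → x ∈ p → (∀ {y} → y ∈ p → y ≡ x) → ∣ p ∣ ≡ 1
  ∣∣≡1 {x = x} x∈ only = trans (cong ∣_∣ (⊆-antisym (λ y∈ → subst (_∈ ⁅ x ⁆) (sym (only y∈)) (x∈⁅x⁆ x))
    (λ y∈ → subst (_∈ _) (sym (x∈⁅y⁆⇒x≡y x y∈)) x∈))) (∣⁅x⁆∣≡1 x)

  ∣∣≡0 : {p : Subset n} → (∀ {y} → y ∉ p) → ∣ p ∣ ≡ 0
  ∣∣≡0 {n} empty = trans (cong ∣_∣ (Empty-unique λ (_ , y∈) → empty y∈)) (∣⊥∣≡0 n)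

  ∣∩∣≡1 : (p q : Subset n) {x : Fin n} → x ∈ p → x ∈ q → (∀ {y} → y ∈ p → y ∈ q → y ≡ x) → ∣ p ∩ q ∣ ≡ 1
  ∣∩∣≡1 p q x∈p x∈q only = ∣∣≡1 (x∈p∩q⁺ (x∈p , x∈q)) λ y∈ → only (proj₁ (x∈p∩q⁻ p q y∈)) (proj₂ (x∈p∩q⁻ p q y∈))

  ∣∩∣≡0 : (p q : Subset n) → (∀ {y} → y ∈ p → y ∉ q) → ∣ p ∩ q ∣ ≡ 0
  ∣∩∣≡0 p q dis = ∣∣≡0 λ y∈ → dis (proj₁ (x∈p∩q⁻ p q y∈)) (proj₂ (x∈p∩q⁻ p q y∈))

  ∣∪∣+∣∩∣ : (p q : Subset n) → ∣ p ∪ q ∣ + ∣ p ∩ q ∣ ≡ ∣ p ∣ + ∣ q ∣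
  ∣∪∣+∣∩∣ []          []          = refl
  ∣∪∣+∣∩∣ (true ∷ p)  (true ∷ q)  = cong suc (trans (+-suc _ _) (trans (cong suc (∣∪∣+∣∩∣ p q)) (sym (+-suc _ _))))
  ∣∪∣+∣∩∣ (true ∷ p)  (false ∷ q) = cong suc (∣∪∣+∣∩∣ p q)
  ∣∪∣+∣∩∣ (false ∷ p) (true ∷ q)  = trans (cong suc (∣∪∣+∣∩∣ p q)) (sym (+-suc _ _))
  ∣∪∣+∣∩∣ (false ∷ p) (false ∷ q) = ∣∪∣+∣∩∣ p q

  ∈⋃⁻ : ∀ (es : List (Subset n)) {x} → x ∈ ⋃ es → ∃[ e ] e ∈ₗ es × x ∈ e
  ∈⋃⁻ []       x∈ = contradiction x∈ ∉⊥
  ∈⋃⁻ (e ∷ es) x∈ with x∈p∪q⁻ e (⋃ es) x∈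
  ... | inj₁ x∈e = e , here refl , x∈e
  ... | inj₂ x∈⋃ with ∈⋃⁻ es x∈⋃
  ...   | f , f∈ , x∈f = f , there f∈ , x∈f

  ∈⋃⁺ : ∀ {es : List (Subset n)} {e x} → e ∈ₗ es → x ∈ e → x ∈ ⋃ es
  ∈⋃⁺ (here refl) x∈ = x∈p∪q⁺ (inj₁ x∈)
  ∈⋃⁺ (there e∈)  x∈ = x∈p∪q⁺ (inj₂ (∈⋃⁺ e∈ x∈))

  lookup-step : Path a es b → ∀ i j → toℕ j ≡ suc (toℕ i) → ∣ lookup es i ∩ lookup es j ∣ ≡ 1
  lookup-step (cons a∈ c∈ _ only (cons c∈f _ _ _ _)) zero (suc zero) _ = ∣∩∣≡1 _ _ c∈ c∈f (only (here refl))
  lookup-step (cons _ _ _ _ p) (suc i) (suc j) eq = lookup-step p i j (suc-injective eq)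

  lookup-disjoint : Path a es b → ∀ i j → suc (toℕ i) < toℕ j → ∀ {x} → x ∈ lookup es i → x ∉ lookup es j
  lookup-disjoint (cons _ _ _ only p@(cons _ _ _ _ _)) zero (suc (suc j)) _ x∈ x∈′
    with refl ← only (there (∈-lookup j)) x∈ x∈′ = start-first p (∈-lookup j) x∈′
  lookup-disjoint (cons _ _ _ _ (cons _ _ _ _ _)) zero (suc zero) (s≤s ())
  lookup-disjoint (cons _ _ _ _ p) (suc i) (suc j) (s≤s lt) = lookup-disjoint p i j lt

  lookup-start : Path a es b → ∀ i → toℕ i ≡ 0 → a ∈ lookup es i
  lookup-start (cons a∈ _ _ _ _) zero _ = a∈

  lookup-start-∉ : Path a es b → ∀ i → 0 < toℕ i → a ∉ lookup es i
  lookup-start-∉ p@(cons _ _ _ _ _) (suc i) _ = start-first p (∈-lookup i)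

  lookup-end : Path a es b → ∀ i → suc (toℕ i) ≡ length es → b ∈ lookup es i
  lookup-end (cons _ c∈ _ _ []) zero _ = c∈
  lookup-end (cons _ _ _ _ p) (suc i) eq = lookup-end p i (suc-injective eq)

  lookup-end-∉ : Path a es b → ∀ i → suc (toℕ i) < length es → b ∉ lookup es i
  lookup-end-∉ {es = _ ∷ es} p zero lt b∈ with refl ← end-only-last p b∈ = contradiction lt (λ { (s≤s ()) })
  lookup-end-∉ (cons _ _ _ _ p) (suc i) (s≤s lt) = lookup-end-∉ p i lt

  path-size : ∀ {s e} → Path a (e ∷ es) b → (∀ {f} → f ∈ₗ (e ∷ es) → ∣ f ∣ ≡ suc s) →
              ∣ ⋃ (e ∷ es) ∣ ≡ suc (s + length es * s)
  path-size {n} {s = s} {e} (cons _ _ _ _ []) unif = begin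
    ∣ e ∪ ⊥ ∣                 ≡⟨ +-identityʳ _ ⟨
    ∣ e ∪ ⊥ ∣ + 0             ≡⟨ cong (∣ e ∪ ⊥ ∣ +_) (∣∩∣≡0 e ⊥ (λ _ → ∉⊥)) ⟨
    ∣ e ∪ ⊥ ∣ + ∣ e ∩ ⊥ ∣     ≡⟨ ∣∪∣+∣∩∣ e ⊥ ⟩
    ∣ e ∣ + ∣ ⊥ {n} ∣             ≡⟨ cong₂ _+_ (unif (here refl)) (∣⊥∣≡0 n) ⟩
    suc (s + 0)               ∎
    where open ≡-Reasoning
  path-size {s = s} {e} (cons {c = c} _ c∈ _ only p@(cons {es = es} {e = f} c∈f _ _ _ _)) unif = +-cancelʳ-≡ 1 _ _ (begin
    ∣ e ∪ U ∣ + 1              ≡⟨ cong (∣ e ∪ U ∣ +_) (∣∩∣≡1 e U c∈ (∈⋃⁺ {es = f ∷ es} (here refl) c∈f)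
                                   (λ y∈ y∈U → let (_ , g∈ , y∈g) = ∈⋃⁻ (f ∷ es) y∈U in only g∈ y∈ y∈g)) ⟨
    ∣ e ∪ U ∣ + ∣ e ∩ U ∣      ≡⟨ ∣∪∣+∣∩∣ e U ⟩
    ∣ e ∣ + ∣ U ∣              ≡⟨ cong₂ _+_ (unif (here refl)) (path-size p (unif ∘ there)) ⟩
    suc s + suc (s + length es * s) ≡⟨ +-suc (suc s) _ ⟩
    suc (suc s + (s + length es * s)) ≡⟨ +-comm 1 _ ⟩
    suc s + (s + length es * s) + 1 ∎)
    where
    open ≡-Reasoning
    U = ⋃ (f ∷ es)

  cyclicSuc⁻ : ∀ {ℓ} (i j : Fin ℓ) → CyclicSuc i j → toℕ j ≡ suc (toℕ i) ⊎ (toℕ j ≡ 0 × suc (toℕ i) ≡ ℓ)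
  cyclicSuc⁻ {suc ℓ} i j eq with suc (toℕ i) <? suc ℓ
  ... | yes lt = inj₁ (trans eq (m<n⇒m%n≡m lt))
  ... | no ≮ with ≤-antisym (Fin.toℕ<n i) (≮⇒≥ ≮)
  ...   | i≡ = inj₂ (trans eq (trans (cong (_% suc ℓ) i≡) (n%n≡0 (suc ℓ))) , i≡)

  cyclicSuc⁺ : ∀ {ℓ} (i j : Fin ℓ) → toℕ j ≡ suc (toℕ i) ⊎ (toℕ j ≡ 0 × suc (toℕ i) ≡ ℓ) → CyclicSuc i j
  cyclicSuc⁺ {suc ℓ} i j (inj₁ eq) = trans eq (sym (m<n⇒m%n≡m (subst (_< suc ℓ) eq (Fin.toℕ<n j))))
  cyclicSuc⁺ {suc ℓ} i j (inj₂ (eq , i≡)) = trans eq (sym (trans (cong (_% suc ℓ) i≡) (n%n≡0 (suc ℓ))))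

  module _ {r : ℕ} (r>0 : 0 < r) {g w : Subset n} {ws′ : List (Subset n)}
           (unif : ∀ {f} → f ∈ₗ (g ∷ w ∷ ws′) → ∣ f ∣ ≡ r)
           (p : Path a (w ∷ ws′) b) (len : 3 ≤ length (w ∷ ws′)) (a∈ : a ∈ g) (b∈ : b ∈ g)
           (only : ∀ {f x} → f ∈ₗ (w ∷ ws′) → x ∈ g → x ∈ f → x ≡ a ⊎ x ≡ b) where

    private
      ws = w ∷ ws′

      e = lookup (g ∷ ws)

      a≢b : a ≢ b
      a≢b = start≢end p

      sym-size : ∀ i j {m} → ∣ e i ∩ e j ∣ ≡ m → ∣ e j ∩ e i ∣ ≡ m
      sym-size i j = trans (cong ∣_∣ (∩-comm (e j) (e i)))

      step : ∀ i j → toℕ j ≡ suc (toℕ i) → ∣ e i ∩ e j ∣ ≡ 1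
      step zero (suc j) eq = ∣∩∣≡1 g (lookup ws j) a∈ (lookup-start p j (suc-injective eq)) λ x∈ x∈′ → case only (∈-lookup j) x∈ x∈′ of λ
        { (inj₁ x≡a) → x≡a
        ; (inj₂ refl) → contradiction x∈′ (lookup-end-∉ p j
            (≤-trans (s≤s (s≤s (≤-reflexive (suc-injective eq)))) (≤-trans (n≤1+n 2) len))) }
      step (suc i) (suc j) eq = lookup-step p i j (suc-injective eq)

      wrap : ∀ i j → toℕ j ≡ 0 → suc (toℕ i) ≡ length (g ∷ ws) → ∣ e i ∩ e j ∣ ≡ 1
      wrap zero    zero eq ()
      wrap (suc i) zero eq i≡ = sym-size zero (suc i)
        (∣∩∣≡1 g (lookup ws i) b∈ (lookup-end p i (suc-injective i≡)) λ x∈ x∈′ → case only (∈-lookup i) x∈ x∈′ of λ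
        { (inj₂ x≡b) → x≡b
        ; (inj₁ refl) → contradiction x∈′ (lookup-start-∉ p i (s≤s⁻¹ (≤-trans (≤-trans (n≤1+n 2) len)
                          (≤-reflexive (sym (suc-injective i≡)))))) })

      apart : ∀ i j → toℕ i < toℕ j → ¬ Adjacent i j → ∣ e i ∩ e j ∣ ≡ 0
      apart zero (suc j) lt ¬adj = ∣∩∣≡0 g (lookup ws j) λ x∈ x∈′ → case only (∈-lookup j) x∈ x∈′ of λ
        { (inj₁ refl) → lookup-start-∉ p j (n≢0⇒n>0 λ eq → ¬adj (inj₁ (cyclicSuc⁺ zero (suc j) (inj₁ (cong suc eq))))) x∈′
        ; (inj₂ refl) → lookup-end-∉ p j (≤∧≢⇒< (Fin.toℕ<n j) λ eq → ¬adj (inj₂ (cyclicSuc⁺ (suc j) zero (inj₂ (refl , cong suc eq))))) x∈′ }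
      apart (suc i) (suc j) (s≤s lt) ¬adj = ∣∩∣≡0 (lookup ws i) (lookup ws j) (lookup-disjoint p i j
        (≤∧≢⇒< lt λ eq → ¬adj (inj₁ (cyclicSuc⁺ (suc i) (suc j) (inj₁ (cong suc (sym eq)))))))

      adj : ∀ i j → CyclicSuc i j → ∣ e i ∩ e j ∣ ≡ 1
      adj i j s with cyclicSuc⁻ i j s
      ... | inj₁ j≡       = step i j j≡
      ... | inj₂ (j≡ , i≡) = wrap i j j≡ i≡

      -- `g` shares exactly `a` and `b` with the path, so it adds `s - 1` vertices to the
      -- `1 + s * length ws` of the path.
      size : ∀ {s} → r ≡ suc s → ∣ g ∪ ⋃ ws ∣ ≡ s * suc (length ws)
      size {s} refl = +-cancelʳ-≡ 2 _ _ (begin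
        ∣ g ∪ U ∣ + 2                                   ≡⟨ cong (∣ g ∪ U ∣ +_) two ⟨
        ∣ g ∪ U ∣ + ∣ g ∩ U ∣                           ≡⟨ ∣∪∣+∣∩∣ g U ⟩
        ∣ g ∣ + ∣ U ∣                                   ≡⟨ cong₂ _+_ (unif (here refl)) (path-size p (unif ∘ there)) ⟩
        suc s + suc (s + length ws′ * s)                 ≡⟨ cong (λ m → suc s + suc m) (*-comm (suc (length ws′)) s) ⟩
        suc s + suc (s * suc (length ws′))               ≡⟨ +-suc (suc s) _ ⟩
        2 + (s + s * suc (length ws′))                   ≡⟨ cong (2 +_) (*-suc s (suc (length ws′))) ⟨
        2 + s * suc (suc (length ws′))                   ≡⟨ +-comm 2 _ ⟩
        s * suc (suc (length ws′)) + 2                   ∎)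
        where
        open ≡-Reasoning
        U = ⋃ (ws)
        pair = ⁅ a ⁆ ∪ ⁅ b ⁆
        two : ∣ g ∩ U ∣ ≡ 2
        two = begin
          ∣ g ∩ U ∣                       ≡⟨ cong ∣_∣ (⊆-antisym to from) ⟩
          ∣ pair ∣                        ≡⟨ +-identityʳ _ ⟨
          ∣ pair ∣ + 0                    ≡⟨ cong (∣ pair ∣ +_) (∣∩∣≡0 ⁅ a ⁆ ⁅ b ⁆ (λ x∈ x∈′ →
                                                a≢b (trans (sym (x∈⁅y⁆⇒x≡y a x∈)) (x∈⁅y⁆⇒x≡y b x∈′)))) ⟨
          ∣ pair ∣ + ∣ ⁅ a ⁆ ∩ ⁅ b ⁆ ∣    ≡⟨ ∣∪∣+∣∩∣ ⁅ a ⁆ ⁅ b ⁆ ⟩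
          ∣ ⁅ a ⁆ ∣ + ∣ ⁅ b ⁆ ∣           ≡⟨ cong₂ _+_ (∣⁅x⁆∣≡1 a) (∣⁅x⁆∣≡1 b) ⟩
          2                               ∎
          where
          to : g ∩ U ⊆ pair
          to x∈ with x∈p∩q⁻ g U x∈
          ... | x∈g , x∈U with ∈⋃⁻ (ws) x∈U
          ...   | h , h∈ , x∈h with only h∈ x∈g x∈h
          ...     | inj₁ refl = x∈p∪q⁺ (inj₁ (x∈⁅x⁆ a))
          ...     | inj₂ refl = x∈p∪q⁺ (inj₂ (x∈⁅x⁆ b))
          from : pair ⊆ g ∩ U
          from x∈ with x∈p∪q⁻ ⁅ a ⁆ ⁅ b ⁆ x∈
          ... | inj₁ x∈a with refl ← x∈⁅y⁆⇒x≡y a x∈a = x∈p∩q⁺ (a∈ , ∈⋃⁺ {es = ws} (here refl) (lookup-start p zero refl))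
          ... | inj₂ x∈b with refl ← x∈⁅y⁆⇒x≡y b x∈b | (h , h∈ , b∈h) ← end-last p = x∈p∩q⁺ (b∈ , ∈⋃⁺ {es = ws} h∈ b∈h)

    closedPath : IsLinearCycle r (suc (length (w ∷ ws′))) (lookup (g ∷ w ∷ ws′))
    closedPath = record
      { length≥3    = ≤-trans len (n≤1+n _)
      ; uniform     = λ i → unif (∈-lookup i)
      ; vertices    = trans (cong (∣_∣ ∘ ⋃) (List.tabulate-lookup (g ∷ ws)))
                            (size (sym (trans (+-comm 1 (r ∸ 1)) (m∸n+n≡m r>0))))
      ; adjacent    = λ { i j (inj₁ s) → adj i j s ; i j (inj₂ s) → sym-size j i (adj j i s) }
      ; nonadjacent = λ i j i≢j ¬adj → case <-cmp (toℕ i) (toℕ j) of λ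
          { (tri< lt _ _) → apart i j lt ¬adj
          ; (tri≈ _ eq _) → contradiction (Fin.toℕ-injective eq) i≢j
          ; (tri> _ _ gt) → sym-size j i (apart j i gt (¬adj ∘ λ { (inj₁ s) → inj₂ s ; (inj₂ s) → inj₁ s })) }
      }

  -- Balls and geodesics

  ∈─⁻ : ∀ {n} (p q : Subset n) {x} → x ∈ p ─ q → x ∈ p × x ∉ q
  ∈─⁻ (true ∷ p)  (false ∷ q) Vec.here = Vec.here , λ ()
  ∈─⁻ (false ∷ p) (true ∷ q)  {zero} ()
  ∈─⁻ (false ∷ p) (false ∷ q) {zero} ()
  ∈─⁻ (_ ∷ p)    (_ ∷ q)     (Vec.there x∈) with ∈─⁻ p q x∈
  ... | x∈p , x∉q = Vec.there x∈p , λ { (Vec.there x∈q) → x∉q x∈q }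

  ∣─∣ : ∀ {n} (p q : Subset n) → q ⊆ p → ∣ q ∣ + ∣ p ─ q ∣ ≤ ∣ p ∣
  ∣─∣ p q q⊆p = ≤-trans (∣∪∣-disjoint q (p ─ q) λ x∈q x∈ → proj₂ (∈─⁻ p q x∈) x∈q)
    (p⊆q⇒∣p∣≤∣q∣ λ x∈ → [ q⊆p , proj₁ ∘ ∈─⁻ p q ]′ (x∈p∪q⁻ q (p ─ q) x∈))

  weighted-card : ∀ {n} (p : Subset n) c → ∑ (allFin n) (λ v → c * 𝟙 (v ∈? p)) ≡ c * ∣ p ∣
  weighted-card {n} p c = trans (∑-*ˡ (allFin n) c _) (cong (c *_) (sym (∣∣≡# p)))

  module Balls {n : ℕ} (E : List (Subset n)) (x : Fin n) where

    -- The disjunct `v ≡ x` starts the growth from the empty set. Thus level `l` is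
    -- `U (suc l) ─ U l` for every `l`, with no special case at the centre.
    Grows : Subset n → Fin n → Set
    Grows U v = v ≡ x ⊎ v ∈ U ⊎ Any (λ e → v ∈ e × Nonempty (e ∩ U)) E

    grows? : ∀ U → Decidable (Grows U)
    grows? U v = (v Fin.≟ x) ⊎-dec ((v ∈? U) ⊎-dec any? (λ e → (v ∈? e) ×-dec (e ∼? U)) E)

    -- U (l + 1) is the ball of radius l around x, and U 0 is empty.
    U : ℕ → Subset n
    U zero    = ⊥
    U (suc l) = ⟪ grows? (U l) ⟫

    centre : ∀ l → x ∈ U (suc l)
    centre l = ∈⟪⟫⁺ (grows? (U l)) (inj₁ refl)

    U-suc : ∀ l → U l ⊆ U (suc l)
    U-suc l v∈ = ∈⟪⟫⁺ (grows? (U l)) (inj₂ (inj₁ v∈))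

    absorb : ∀ l {e} → e ∈ₗ E → Nonempty (e ∩ U l) → e ⊆ U (suc l)
    absorb l e∈ meets v∈e = ∈⟪⟫⁺ (grows? (U l)) (inj₂ (inj₂ (lose e∈ (v∈e , meets))))

    covered : ∀ {e₀} → e₀ ∈ₗ E → x ∈ e₀ → ∀ l {v} → v ∈ U l → ∃[ e ] e ∈ₗ E × v ∈ e
    covered e₀∈ x∈ zero    v∈ = contradiction v∈ ∉⊥
    covered e₀∈ x∈ (suc l) v∈ with ∈⟪⟫⁻ (grows? (U l)) v∈
    ... | inj₁ refl       = _ , e₀∈ , x∈
    ... | inj₂ (inj₁ v∈U) = covered e₀∈ x∈ l v∈U
    ... | inj₂ (inj₂ any) with find any
    ...   | e , e∈ , v∈e , _ = e , e∈ , v∈e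

    -- Levels `l` and `l + 1` together. An edge whose lowest vertices are on level `l` lies here
    -- entirely, since one more step absorbs it.
    layer : ℕ → Subset n
    layer l = U (suc (suc l)) ─ U l

    fresh? : ∀ l → Decidable (λ e → Nonempty (e ∩ U (suc l)) × ¬ Nonempty (e ∩ U l))
    fresh? l e = (e ∼? U (suc l)) ×-dec ¬? (e ∼? U l)

    fresh⊆layer : ∀ l {e} → e ∈ₗ filter (fresh? l) E → e ⊆ layer l
    fresh⊆layer l {e} e∈ v∈ with ∈-filter⁻ (fresh? l) {xs = E} e∈
    ... | e∈E , meets , avoids = x∈p∧x∉q⇒x∈p─q (absorb (suc l) e∈E meets v∈) λ v∈U → avoids (_ , x∈p∩q⁺ (v∈ , v∈U))

    module _ {δ r D : ℕ} {e₀ : Subset n} (e₀∈ : e₀ ∈ₗ E) (x∈e₀ : x ∈ e₀)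
             (unif : ∀ {e} → e ∈ₗ E → ∣ e ∣ ≡ r) (high : ∀ {e v} → e ∈ₗ E → v ∈ e → δ < deg E v) where

      degree-sum : ∀ l → δ * ∣ U l ∣ ≤ r * # (_∼? U l) E
      degree-sum l = begin
        δ * ∣ U l ∣                                        ≡⟨ weighted-card (U l) δ ⟨
        ∑ (allFin n) (λ v → δ * 𝟙 (v ∈? U l))              ≤⟨ ∑-mono (allFin n) (λ {v} _ → low v (v ∈? U l)) ⟩
        ∑ (allFin n) (λ v → 𝟙 (v ∈? U l) * deg E v)        ≡⟨ handshake E (U l) ⟩
        ∑ E (λ e → ∣ e ∩ U l ∣)                            ≤⟨ ∑-mono E (λ {e} e∈ → meet e e∈ (e ∼? U l)) ⟩
        ∑ E (λ e → r * 𝟙 (e ∼? U l))                       ≡⟨ ∑-*ˡ E r _ ⟩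
        r * # (_∼? U l) E                                  ∎
        where
        open ≤-Reasoning
        low : ∀ v (d : Dec (v ∈ U l)) → δ * 𝟙 d ≤ 𝟙 d * deg E v
        low v (no _) = ≤-reflexive (*-zeroʳ δ)
        low v (yes v∈) with covered e₀∈ x∈e₀ l v∈
        ... | e , e∈ , v∈e = ≤-trans (≤-reflexive (*-identityʳ δ))
                               (≤-trans (<⇒≤ (high e∈ v∈e)) (≤-reflexive (sym (*-identityˡ _))))
        meet : ∀ e → e ∈ₗ E → (d : Dec (Nonempty (e ∩ U l))) → ∣ e ∩ U l ∣ ≤ r * 𝟙 d
        meet e e∈ (yes _) = ≤-trans (p⊆q⇒∣p∣≤∣q∣ (proj₁ ∘ x∈p∩q⁻ e (U l)))
                              (≤-reflexive (trans (unif e∈) (sym (*-identityʳ r))))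
        meet e e∈ (no ∄)  = ≤-trans (≤-reflexive (∣∣≡0 λ y∈ → ∄ (_ , y∈))) z≤n

      -- The edges that touch `U j` are sorted by the lowest level they meet. Passing from `j` to
      -- `suc j` admits the edges fresh at `j`, while `∣ U j ∣ + ∣ U (suc j) ∣` grows by the size of
      -- `layer j`.
      touching : ∀ {M} → (∀ {l} → l < M → length (filter (fresh? l) E) ≤ D * ∣ layer l ∣) →
                 ∀ j → j ≤ M → # (_∼? U j) E ≤ D * (∣ U j ∣ + ∣ U (suc j) ∣)
      touching sparse zero j≤ = ≤-trans (≤-reflexive (#-none (_∼? ⊥) E λ {e} _ (_ , y∈) → ∉⊥ (proj₂ (x∈p∩q⁻ e ⊥ y∈)))) z≤n
      touching sparse (suc j) j< = begin
        # (_∼? U (suc j)) E                                        ≤⟨ ∑-mono E (λ {e} _ → split e) ⟩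
        ∑ E (λ e → 𝟙 (e ∼? U j) + 𝟙 (fresh? j e))                  ≡⟨ ∑-+ E _ _ ⟩
        # (_∼? U j) E + # (fresh? j) E                             ≡⟨ cong (# (_∼? U j) E +_) (#-filter (fresh? j) E) ⟨
        # (_∼? U j) E + length (filter (fresh? j) E)               ≤⟨ +-mono-≤ (touching sparse j (<⇒≤ j<)) (sparse j<) ⟩
        D * (∣ U j ∣ + ∣ U (suc j) ∣) + D * ∣ layer j ∣            ≡⟨ *-distribˡ-+ D _ ∣ layer j ∣ ⟨
        D * (∣ U j ∣ + ∣ U (suc j) ∣ + ∣ layer j ∣)                ≡⟨ cong (D *_) (trans (cong (_+ ∣ layer j ∣) (+-comm ∣ U j ∣ _)) (+-assoc ∣ U (suc j) ∣ _ _)) ⟩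
        D * (∣ U (suc j) ∣ + (∣ U j ∣ + ∣ layer j ∣))              ≤⟨ *-monoʳ-≤ D (+-monoʳ-≤ ∣ U (suc j) ∣
                                                                        (∣─∣ (U (suc (suc j))) (U j) (λ v∈ → U-suc (suc j) (U-suc j v∈)))) ⟩
        D * (∣ U (suc j) ∣ + ∣ U (suc (suc j)) ∣)                  ∎
        where
        open ≤-Reasoning
        split : ∀ e → 𝟙 (e ∼? U (suc j)) ≤ 𝟙 (e ∼? U j) + 𝟙 (fresh? j e)
        split e with e ∼? U (suc j) | e ∼? U j
        ... | no _  | _     = z≤n
        ... | yes _ | yes _ = s≤s z≤n
        ... | yes _ | no _  = ≤-refl

      growth : ∀ {M} → (∀ {l} → l < M → length (filter (fresh? l) E) ≤ D * ∣ layer l ∣) →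
               ∀ j → j ≤ M → δ * ∣ U j ∣ ≤ 2 * r * D * ∣ U (suc j) ∣
      growth sparse j j≤ = begin
        δ * ∣ U j ∣                                  ≤⟨ degree-sum j ⟩
        r * # (_∼? U j) E                            ≤⟨ *-monoʳ-≤ r (touching sparse j j≤) ⟩
        r * (D * (∣ U j ∣ + ∣ U (suc j) ∣))          ≤⟨ *-monoʳ-≤ r (*-monoʳ-≤ D (+-monoˡ-≤ ∣ U (suc j) ∣ (p⊆q⇒∣p∣≤∣q∣ (U-suc j)))) ⟩
        r * (D * (∣ U (suc j) ∣ + ∣ U (suc j) ∣))    ≡⟨ solve 3 (λ r D u → r :* (D :* (u :+ u)) := con 2 :* r :* D :* u) refl r D ∣ U (suc j) ∣ ⟩
        2 * r * D * ∣ U (suc j) ∣                    ∎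
        where
        open ≤-Reasoning
        open +-*-Solver

      powers : ∀ {M} → (∀ {l} → l < M → length (filter (fresh? l) E) ≤ D * ∣ layer l ∣) →
               ∀ j → j ≤ M → δ ^ j ≤ (2 * r * D) ^ j * ∣ U (suc j) ∣
      powers sparse zero j≤ = ≤-trans (≤-trans (≤-reflexive (sym (∣⁅x⁆∣≡1 x)))
        (p⊆q⇒∣p∣≤∣q∣ λ y∈ → subst (_∈ U 1) (sym (x∈⁅y⁆⇒x≡y x y∈)) (centre 0))) (≤-reflexive (sym (+-identityʳ _)))
      powers sparse (suc j) j< = begin
        δ * δ ^ j                              ≤⟨ *-monoʳ-≤ δ (powers sparse j (<⇒≤ j<)) ⟩
        δ * (K ^ j * u)                        ≡⟨ solve 3 (λ a b c → a :* (b :* c) := b :* (a :* c)) refl δ (K ^ j) u ⟩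
        K ^ j * (δ * u)                        ≤⟨ *-monoʳ-≤ (K ^ j) (growth sparse (suc j) j<) ⟩
        K ^ j * (K * u′)                       ≡⟨ solve 3 (λ a b c → a :* (b :* c) := b :* a :* c) refl (K ^ j) K u′ ⟩
        K * K ^ j * u′                         ∎
        where
        open ≤-Reasoning
        open +-*-Solver
        K = 2 * r * D
        u = ∣ U (suc j) ∣
        u′ = ∣ U (suc (suc j)) ∣

      denseLayer : ∀ M → (2 * r * D) ^ M * n < δ ^ M →
                   ∃[ l ] l < M × D * ∣ layer l ∣ < length (filter (fresh? l) E)
      denseLayer M big with anyUpTo? (λ l → D * ∣ layer l ∣ <? length (filter (fresh? l) E)) M
      ... | yes found = found
      ... | no ∄ = contradiction (≤-<-trans (powers (λ {l} l< → ≮⇒≥ λ lt → ∄ (l , l< , lt)) M ≤-refl)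
                     (≤-<-trans (*-monoʳ-≤ ((2 * r * D) ^ M) (∣p∣≤n (U (suc M)))) big)) (<-irrefl refl)

    module _ {r : ℕ} (lin : Lin E) (unif : ∀ {e} → e ∈ₗ E → ∣ e ∣ ≡ r) where

      -- `first` stands for the first edge of the route, or `⊥` if the route is empty; `nearby`
      -- collects the vertices other than `v` of the first two edges. Only these may return to the
      -- levels of a spot: by `avoids`, the rest lies in `U (pred l)`.
      record Geodesic (l : ℕ) (v : Fin n) : Set where
        field
          route    : List (Subset n)
          path     : Path v route x
          len      : length route ≡ l
          inE      : ∀ {f} → f ∈ₗ route → f ∈ₗ E
          inBall   : ∀ {f} → f ∈ₗ route → f ⊆ U (suc l)
          first    : Subset n
          first≤   : ∣ first ∣ ≤ r
          later    : ∀ {f} → f ∈ₗ route → (f ≡ first × v ∈ f) ⊎ f ⊆ U l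
          nearby   : Subset n
          nearby≤  : ∣ nearby ∣ ≤ 2 * r
          v∉nearby : v ∉ nearby
          avoids   : ∀ {f y} → f ∈ₗ route → y ∈ f → y ≡ v ⊎ y ∈ nearby ⊎ y ∈ U (pred l)

      -- The edge `e` that reached `v` meets `U (suc l)` in some `u` but misses `U l`, for otherwise
      -- `v` would have been reached earlier. So `u` is exactly one level lower, and the recursion
      -- applies to it.
      geodesic : ∀ l {v} → v ∈ U (suc l) → v ∉ U l → Geodesic l v
      geodesic zero {v} v∈ v∉ with ∈⟪⟫⁻ (grows? ⊥) v∈
      ... | inj₁ refl = record
        { route = [] ; path = [] ; len = refl ; inE = λ () ; inBall = λ () ; first = ⊥ ; first≤ = bound ; later = λ ()
        ; nearby = ⊥ ; nearby≤ = ≤-trans bound (m≤m+n r _) ; v∉nearby = ∉⊥ ; avoids = λ () }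
        where
        bound : ∣ ⊥ {n} ∣ ≤ r
        bound = ≤-trans (≤-reflexive (∣⊥∣≡0 n)) z≤n
      ... | inj₂ (inj₁ v∈⊥) = contradiction v∈⊥ ∉⊥
      ... | inj₂ (inj₂ any) with find any
      ...   | e , _ , _ , _ , y∈ = contradiction (proj₂ (x∈p∩q⁻ e ⊥ y∈)) ∉⊥
      geodesic (suc l) {v} v∈ v∉ with ∈⟪⟫⁻ (grows? (U (suc l))) v∈
      ... | inj₁ refl = contradiction (centre l) v∉
      ... | inj₂ (inj₁ v∈U) = contradiction v∈U v∉
      ... | inj₂ (inj₂ any) with find any
      ...   | e , e∈ , v∈e , u , u∈ = record
        { route = e ∷ route ; path = cons v∈e u∈e (λ { refl → v∉ u∈U }) only path
        ; len = cong suc len ; inE = λ { (here refl) → e∈ ; (there f∈) → inE f∈ }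
        ; inBall = λ { (here refl) → absorb (suc l) e∈ (u , u∈) ; (there f∈) y∈ → U-suc (suc l) (inBall f∈ y∈) }
        ; first = e ; first≤ = ≤-reflexive (unif e∈)
        ; later = λ { (here refl) → inj₁ (refl , v∈e) ; (there f∈) → inj₂ (inBall f∈) }
        ; nearby = (e ∪ first) - v
        ; nearby≤ = ≤-trans (p⊆q⇒∣p∣≤∣q∣ (p─q⊆p (e ∪ first) ⁅ v ⁆)) (≤-trans (∣∪∣≤ e first)
                      (+-mono-≤ (≤-reflexive (unif e∈)) (≤-trans first≤ (m≤m+n r 0))))
        ; v∉nearby = λ v∈ → proj₂ (∈─⁻ (e ∪ first) ⁅ v ⁆ v∈) (x∈⁅x⁆ v)
        ; avoids = avoids′ }
        where
        u∈e = proj₁ (x∈p∩q⁻ e (U (suc l)) u∈)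
        u∈U = proj₂ (x∈p∩q⁻ e (U (suc l)) u∈)
        outside : ∀ {y} → y ∈ e → y ∉ U l
        outside y∈e y∈U = v∉ (absorb l e∈ (_ , x∈p∩q⁺ (y∈e , y∈U)) v∈e)
        open Geodesic (geodesic l u∈U (outside u∈e))
        -- Edges of the route after the first lie in `U l`, which `e` misses. The first edge
        -- contains `u`, as `e` does, and differs from `e` because it misses `v`; by linearity the
        -- two share nothing else.
        only : ∀ {f y} → f ∈ₗ route → y ∈ e → y ∈ f → y ≡ u
        only {y = y} f∈ y∈e y∈f with later f∈
        ... | inj₂ f⊆ = contradiction (f⊆ y∈f) (outside y∈e)
        ... | inj₁ (_ , u∈f) with y Fin.≟ u
        ...   | yes eq = eq
        ...   | no y≢u with refl ← lin e∈ (inE f∈) y≢u y∈e u∈e y∈f u∈f = contradiction (inBall f∈ v∈e) v∉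
        near : ∀ {y} → y ∈ e ∪ first → y ≡ v ⊎ y ∈ (e ∪ first) - v ⊎ y ∈ U l
        near {y} y∈ with y Fin.≟ v
        ... | yes eq = inj₁ eq
        ... | no y≢v = inj₂ (inj₁ (x∈p∧x≢y⇒x∈p-y y∈ y≢v))
        avoids′ : ∀ {f y} → f ∈ₗ (e ∷ route) → y ∈ f → y ≡ v ⊎ y ∈ (e ∪ first) - v ⊎ y ∈ U l
        avoids′ (here refl) y∈ = near (x∈p∪q⁺ (inj₁ y∈))
        avoids′ (there f∈) y∈ with later f∈
        ... | inj₁ (refl , _) = near (x∈p∪q⁺ (inj₂ y∈))
        ... | inj₂ f⊆ = inj₂ (inj₂ (f⊆ y∈))

  -- Spots

  another : ∀ {n} (p : Subset n) → 2 ≤ ∣ p ∣ → ∀ u → ∃[ v ] v ∈ p × v ≢ u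
  another p two u with Fin.any? (λ v → (v ∈? p) ×-dec ¬? (v Fin.≟ u))
  ... | yes found = found
  ... | no ∄ = contradiction (≤-trans two (≤-trans (p⊆q⇒∣p∣≤∣q∣ within) (≤-reflexive (∣⁅x⁆∣≡1 u)))) λ { (s≤s ()) }
    where
    within : p ⊆ ⁅ u ⁆
    within {v} v∈ with v Fin.≟ u
    ... | yes refl = x∈⁅x⁆ u
    ... | no v≢u = contradiction (v , v∈ , v≢u) ∄

  record PrivatePath {n} (E F : List (Subset n)) (x v : Fin n) : Set where
    field
      route   : List (Subset n)
      path    : Path v route x
      inE     : ∀ {g} → g ∈ₗ route → g ∈ₗ E
      onlyStart : ∀ {g h y} → g ∈ₗ route → h ∈ₗ F → y ∈ g → y ∈ h → y ≡ v

  open PrivatePath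

  -- One record for both roles. The outer spot provides `access`, where a bound on the length is
  -- enough. The inner spot provides `exact`: from the vertices of `target`, of which every edge has
  -- two, all private paths have the same length.
  record Spot {n} (E : List (Subset n)) (x : Fin n) (δ M : ℕ) : Set where
    field
      F        : List (Subset n)
      distinct : Unique F
      F⊆E      : ∀ {f} → f ∈ₗ F → f ∈ₗ E
      nonempty : ∃[ f ] f ∈ₗ F
      high     : ∀ {f v} → f ∈ₗ F → v ∈ f → δ < deg F v
      access   : ∀ {f v} → f ∈ₗ F → v ∈ f → Σ[ p ∈ PrivatePath E F x v ] length (route p) ≤ M
      level    : ℕ
      level≤   : level ≤ M
      target   : Subset n
      twice    : ∀ {f} → f ∈ₗ F → 2 ≤ ∣ f ∩ target ∣
      exact    : ∀ {f v} → f ∈ₗ F → v ∈ f → v ∈ target → Σ[ p ∈ PrivatePath E F x v ] length (route p) ≡ level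

  -- `e₀` to `e₃` count the edges of a layer of `b` vertices through three deletions, which cost
  -- `c * b` edges, a factor `2` and a factor `p`.
  density-loss : ∀ {c p δ b e₀ e₁ e₂ e₃} → (c + 2 * p * δ) * b < e₀ → e₀ ≤ c * b + e₁ → e₁ ≤ 2 * e₂ → e₂ ≤ p * e₃ →
                 δ * b < e₃
  density-loss {c} {p} {δ} {b} {e₀} {e₁} {e₂} {e₃} dense le₁ le₂ le₃ = *-cancelˡ-< (2 * p) _ _ (+-cancelˡ-< (c * b) _ _ (begin-strict
    c * b + 2 * p * (δ * b)       ≡⟨ solve 4 (λ c p δ b → c :* b :+ con 2 :* p :* (δ :* b) := (c :+ con 2 :* p :* δ) :* b) refl c p δ b ⟩
    (c + 2 * p * δ) * b           <⟨ dense ⟩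
    e₀                            ≤⟨ le₁ ⟩
    c * b + e₁                    ≤⟨ +-monoʳ-≤ (c * b) le₂ ⟩
    c * b + 2 * e₂                ≤⟨ +-monoʳ-≤ (c * b) (*-monoʳ-≤ 2 le₃) ⟩
    c * b + 2 * (p * e₃)          ≡⟨ cong (c * b +_) (*-assoc 2 p e₃) ⟨
    c * b + 2 * p * e₃            ∎))
    where
    open ≤-Reasoning
    open +-*-Solver

  -- An edge has r vertices, and the first two edges of the geodesic of each of them have at most 2r vertices.
  bits : ℕ → ℕ
  bits r = r + r * (2 * r)

  -- How many edges per layer vertex leave more than `δ` in the end: `2 * r` pays for the bad edges,
  -- the factor `2` for settling on one of two levels, and `2 ^ bits r` for the separation.
  density : ℕ → ℕ → ℕ
  density r δ = 2 * r + 2 * 2 ^ bits r * δ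

  module _ {n r : ℕ} (r≥3 : 3 ≤ r) where

    module _ {E : List (Subset n)} {x : Fin n} {δ δ′ M : ℕ} {e₀ : Subset n} (e₀∈ : e₀ ∈ₗ E) (x∈e₀ : x ∈ e₀)
             (distinct : Unique E) (lin : Lin E) (unif : ∀ {e} → e ∈ₗ E → ∣ e ∣ ≡ r)
             (high : ∀ {e v} → e ∈ₗ E → v ∈ e → δ < deg E v)
             (big : (2 * r * density r δ′) ^ M * n < δ ^ M) where

      open Balls E x

      privatise : ∀ {F X Z j v} (p : Geodesic lin unif j v) →
                  (∀ {f y} → f ∈ₗ Geodesic.route p → y ∈ f → y ≡ v ⊎ y ∈ X ⊎ y ∈ Z) →
                  (∀ {h y} → h ∈ₗ F → y ∈ h → y ∉ X) → (∀ {h y} → h ∈ₗ F → y ∈ h → y ∉ Z) →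
                  Σ[ p ∈ PrivatePath E F x v ] length (route p) ≡ j
      privatise p near apart outside = record
        { route = Geodesic.route p ; path = Geodesic.path p ; inE = Geodesic.inE p
        ; onlyStart = λ g∈ h∈ y∈g y∈h → case near g∈ y∈g of λ
            { (inj₁ eq) → eq
            ; (inj₂ (inj₁ y∈X)) → contradiction y∈X (apart h∈ y∈h)
            ; (inj₂ (inj₂ y∈Z)) → contradiction y∈Z (outside h∈ y∈h) } } , Geodesic.len p

      private
        D = density r δ′

        module Inside (l : ℕ) (l<M : l < M) (dense : D * ∣ layer l ∣ < length (filter (fresh? l) E)) where

          L = layer l

          -- The separation needs one set `X` per vertex, whereas a geodesic depends on the level of
          -- `v`. So `toX` is conditional on `v` lying on level `j`, and vertices off the layer can
          -- get the empty set.
          record Nearby (v : Fin n) : Set where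
            field
              X    : Subset n
              X≤   : ∣ X ∣ ≤ 2 * r
              v∉X  : v ∉ X
              toX  : ∀ j → j ≡ l ⊎ j ≡ suc l → v ∈ U (suc j) → v ∉ U j →
                     Σ[ p ∈ Geodesic lin unif j v ] (∀ {f y} → f ∈ₗ Geodesic.route p → y ∈ f → y ≡ v ⊎ y ∈ X ⊎ y ∈ U l)

          fromGeodesic : ∀ {v} j → j ≡ l ⊎ j ≡ suc l → v ∈ U (suc j) → v ∉ U j → Nearby v
          fromGeodesic {v} j j≡ v∈ v∉ = record
            { X = nearby ; X≤ = nearby≤ ; v∉X = v∉nearby ; toX = λ i i≡ v∈ᵢ v∉ᵢ → reach i i≡ (same i v∈ᵢ v∉ᵢ) }
            where
            p = geodesic lin unif j v∈ v∉
            open Geodesic p using (nearby; nearby≤; v∉nearby; avoids)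
            U-≤ : ∀ {a b} → a ≤′ b → U a ⊆ U b
            U-≤ ≤′-refl v∈ = v∈
            U-≤ {b = suc b} (≤′-step le) v∈ = U-suc b (U-≤ le v∈)
            same : ∀ i → v ∈ U (suc i) → v ∉ U i → i ≡ j
            same i v∈ᵢ v∉ᵢ with <-cmp i j
            ... | tri< lt _ _ = contradiction (U-≤ (≤⇒≤′ lt) v∈ᵢ) v∉
            ... | tri≈ _ eq _ = eq
            ... | tri> _ _ gt = contradiction (U-≤ (≤⇒≤′ gt) v∈) v∉ᵢ
            -- On either level the remote part of the geodesic stays in `U l`, which the edges of
            -- the layer avoid.
            pred⊆ : ∀ i → i ≡ l ⊎ i ≡ suc l → U (pred i) ⊆ U l
            pred⊆ zero    (inj₁ refl) y∈ = y∈
            pred⊆ (suc i) (inj₁ refl) y∈ = U-suc i y∈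
            pred⊆ .(suc l) (inj₂ refl) y∈ = y∈
            reach : ∀ i → i ≡ l ⊎ i ≡ suc l → i ≡ j →
                    Σ[ p ∈ Geodesic lin unif i v ] (∀ {f y} → f ∈ₗ Geodesic.route p → y ∈ f → y ≡ v ⊎ y ∈ nearby ⊎ y ∈ U l)
            reach i i≡ refl = p , λ f∈ y∈ → case avoids f∈ y∈ of λ
              { (inj₁ eq) → inj₁ eq ; (inj₂ (inj₁ y∈X)) → inj₂ (inj₁ y∈X) ; (inj₂ (inj₂ y∈U)) → inj₂ (inj₂ (pred⊆ i i≡ y∈U)) }

          abstract
            near : ∀ v → Nearby v
            near v with v ∈? U l | v ∈? U (suc l) | v ∈? U (suc (suc l))
            ... | no v∉ | yes v∈ | _      = fromGeodesic l (inj₁ refl) v∈ v∉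
            ... | _     | no v∉  | yes v∈ = fromGeodesic (suc l) (inj₂ refl) v∈ v∉
            ... | yes v∈ | yes v∈′ | _    = record { X = ⊥ ; X≤ = ≤-trans (≤-reflexive (∣⊥∣≡0 n)) z≤n ; v∉X = ∉⊥
              ; toX = λ { j (inj₁ refl) _ v∉ → contradiction v∈ v∉ ; j (inj₂ refl) _ v∉ → contradiction v∈′ v∉ } }
            ... | _     | no v∉ | no v∉′  = record { X = ⊥ ; X≤ = ≤-trans (≤-reflexive (∣⊥∣≡0 n)) z≤n ; v∉X = ∉⊥
              ; toX = λ { j (inj₁ refl) v∈ _ → contradiction v∈ v∉ ; j (inj₂ refl) v∈ _ → contradiction v∈ v∉′ } }

          X : Fin n → Subset n
          X v = Nearby.X (near v)

          E₀ = filter (fresh? l) E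

          E₀⊆E : ∀ {f} → f ∈ₗ E₀ → f ∈ₗ E
          E₀⊆E f∈ = proj₁ (∈-filter⁻ (fresh? l) {xs = E} f∈)

          -- No `C` can contain a bad edge and avoid the set `around` it, so bad edges must go
          -- before the separation.
          Bad : Subset n → Set
          Bad f = ∃[ v ] v ∈ f × Nonempty (f ∩ X v)

          bad? : Decidable Bad
          bad? f = Fin.any? (λ v → (v ∈? f) ×-dec (f ∼? X v))

          -- For each `v` of the layer, `meeting≤` leaves at most `∣ X v ∣` edges through `v` that
          -- meet `X v`, and edges of `E₀` have all their vertices in the layer.
          badCount : # bad? E₀ ≤ 2 * r * ∣ L ∣
          badCount = begin
            # bad? E₀                                                              ≤⟨ ∑-mono E₀ (λ {f} _ → 𝟙≤ (bad? f) (witness f)) ⟩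
            ∑ E₀ (λ f → ∑ (allFin n) (λ v → 𝟙 ((v ∈? f) ×-dec (f ∼? X v))))        ≡⟨ ∑-swap E₀ (allFin n) _ ⟩
            ∑ (allFin n) (λ v → # (λ f → (v ∈? f) ×-dec (f ∼? X v)) E₀)            ≤⟨ ∑-mono (allFin n) (λ {v} _ → each v (v ∈? L)) ⟩
            ∑ (allFin n) (λ v → 2 * r * 𝟙 (v ∈? L))                                ≡⟨ weighted-card L (2 * r) ⟩
            2 * r * ∣ L ∣                                                          ∎
            where
            open ≤-Reasoning
            witness : ∀ f → Bad f → 1 ≤ ∑ (allFin n) (λ v → 𝟙 ((v ∈? f) ×-dec (f ∼? X v)))
            witness f (v , w) = ≤-trans (≤-reflexive (sym (𝟙-yes ((v ∈? f) ×-dec (f ∼? X v)) w)))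
              (∑-∈ (λ v → 𝟙 ((v ∈? f) ×-dec (f ∼? X v))) (∈-allFin v))
            each : ∀ v (d : Dec (v ∈ L)) → # (λ f → (v ∈? f) ×-dec (f ∼? X v)) E₀ ≤ 2 * r * 𝟙 d
            each v (yes _) = ≤-trans (meeting≤ (unique-filter (fresh? l) distinct) (λ e∈ f∈ → lin (E₀⊆E e∈) (E₀⊆E f∈))
                               (X v) (Nearby.v∉X (near v))) (≤-trans (Nearby.X≤ (near v)) (≤-reflexive (sym (*-identityʳ _))))
            each v (no v∉) = ≤-trans (≤-reflexive (#-none (λ f → (v ∈? f) ×-dec (f ∼? X v)) E₀
                               λ f∈ (v∈f , _) → v∉ (fresh⊆layer l f∈ v∈f))) z≤n

          E₁ = filter (¬? ∘ bad?) E₀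

          E₁⊆E₀ : ∀ {f} → f ∈ₗ E₁ → f ∈ₗ E₀
          E₁⊆E₀ f∈ = proj₁ (∈-filter⁻ (¬? ∘ bad?) {xs = E₀} f∈)

          layerSet : ℕ → Subset n
          layerSet j = U (suc j) ─ U j

          twice? : ∀ j → Decidable (λ f → 2 ≤ ∣ f ∩ layerSet j ∣)
          twice? j f = 2 ≤? ∣ f ∩ layerSet j ∣

          level-of : ∀ {v} → v ∈ L → v ∈ layerSet l ⊎ v ∈ layerSet (suc l)
          level-of {v} v∈L with ∈─⁻ (U (suc (suc l))) (U l) v∈L
          ... | v∈ , v∉ with v ∈? U (suc l)
          ...   | yes v∈′ = inj₁ (x∈p∧x∉q⇒x∈p─q v∈′ v∉)
          ...   | no v∉′  = inj₂ (x∈p∧x∉q⇒x∈p─q v∈ v∉′)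

          twice-one : ∀ {f} → f ∈ₗ E₀ → 1 ≤ 𝟙 (twice? l f) + 𝟙 (twice? (suc l) f)
          twice-one {f} f∈ with twice? l f | twice? (suc l) f
          ... | yes _ | _     = s≤s z≤n
          ... | no _  | yes _ = s≤s z≤n
          ... | no ≱ | no ≱′  = contradiction (begin-strict
            2                                                      <⟨ r≥3 ⟩
            r                                                      ≡⟨ unif (E₀⊆E f∈) ⟨
            ∣ f ∣                                                  ≤⟨ p⊆q⇒∣p∣≤∣q∣ (λ v∈ → x∈p∪q⁺ (case level-of (fresh⊆layer l f∈ v∈) of λ
                                                                        { (inj₁ h) → inj₁ (x∈p∩q⁺ (v∈ , h)) ; (inj₂ h) → inj₂ (x∈p∩q⁺ (v∈ , h)) })) ⟩
            ∣ (f ∩ layerSet l) ∪ (f ∩ layerSet (suc l)) ∣          ≤⟨ ∣∪∣≤ (f ∩ layerSet l) (f ∩ layerSet (suc l)) ⟩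
            ∣ f ∩ layerSet l ∣ + ∣ f ∩ layerSet (suc l) ∣          ≤⟨ +-mono-≤ (s≤s⁻¹ (≰⇒> ≱)) (s≤s⁻¹ (≰⇒> ≱′)) ⟩
            2                                                      ∎) (<-irrefl refl)
            where open ≤-Reasoning

          abstract
            -- An edge has at least three vertices, on two levels, hence two on one of them.
            majority : ∃[ j ] (j ≡ l ⊎ j ≡ suc l) × length E₁ ≤ 2 * # (twice? j) E₁
            majority = [ (λ le → suc l , inj₂ refl , ≤-trans total (+-mono-≤ le (≤-reflexive (sym (+-identityʳ _)))))
                       , (λ le → l , inj₁ refl , ≤-trans total (+-monoʳ-≤ (# (twice? l) E₁) (≤-trans le (≤-reflexive (sym (+-identityʳ _))))))
                       ]′ (≤-total (# (twice? l) E₁) (# (twice? (suc l)) E₁))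
              where
              open ≤-Reasoning
              one? : Decidable (λ (f : Subset n) → f ≡ f)
              one? f = yes refl
              total : length E₁ ≤ # (twice? l) E₁ + # (twice? (suc l)) E₁
              total = begin
                length E₁                                                  ≡⟨ #-all one? E₁ (λ _ → refl) ⟨
                # one? E₁                                                  ≤⟨ ∑-mono E₁ (λ f∈ → twice-one (E₁⊆E₀ f∈)) ⟩
                ∑ E₁ (λ f → 𝟙 (twice? l f) + 𝟙 (twice? (suc l) f))          ≡⟨ ∑-+ E₁ _ _ ⟩
                # (twice? l) E₁ + # (twice? (suc l)) E₁                    ∎

          t = proj₁ majority
          t≡ = proj₁ (proj₂ majority)
          E₂ = filter (twice? t) E₁

          E₂⊆E₁ : ∀ {f} → f ∈ₗ E₂ → f ∈ₗ E₁
          E₂⊆E₁ f∈ = proj₁ (∈-filter⁻ (twice? t) {xs = E₁} f∈)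

          around? : ∀ f → Decidable (λ y → ∃[ v ] v ∈ f × y ∈ X v)
          around? f y = Fin.any? (λ v → (v ∈? f) ×-dec (y ∈? X v))

          around : Subset n → Subset n
          around f = ⟪ around? f ⟫

          around-size : ∀ f → ∣ around f ∣ ≤ ∣ f ∣ * (2 * r)
          around-size f = begin
            ∣ around f ∣                                                              ≡⟨ ∣∣≡# (around f) ⟩
            # (_∈? around f) (allFin n)                                               ≤⟨ ∑-mono (allFin n) (λ {y} _ → 𝟙≤ (y ∈? around f) (witness y)) ⟩
            ∑ (allFin n) (λ y → ∑ (allFin n) (λ v → 𝟙 ((v ∈? f) ×-dec (y ∈? X v))))   ≡⟨ ∑-swap (allFin n) (allFin n) _ ⟩
            ∑ (allFin n) (λ v → # (λ y → (v ∈? f) ×-dec (y ∈? X v)) (allFin n))       ≤⟨ ∑-mono (allFin n) (λ {v} _ → each v (v ∈? f)) ⟩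
            ∑ (allFin n) (λ v → 2 * r * 𝟙 (v ∈? f))                                   ≡⟨ weighted-card f (2 * r) ⟩
            2 * r * ∣ f ∣                                                             ≡⟨ *-comm (2 * r) ∣ f ∣ ⟩
            ∣ f ∣ * (2 * r)                                                           ∎
            where
            open ≤-Reasoning
            witness : ∀ y → y ∈ around f → 1 ≤ ∑ (allFin n) (λ v → 𝟙 ((v ∈? f) ×-dec (y ∈? X v)))
            witness y y∈ with ∈⟪⟫⁻ (around? f) y∈
            ... | v , w = ≤-trans (≤-reflexive (sym (𝟙-yes ((v ∈? f) ×-dec (y ∈? X v)) w)))
                            (∑-∈ (λ v → 𝟙 ((v ∈? f) ×-dec (y ∈? X v))) (∈-allFin v))
            each : ∀ v (d : Dec (v ∈ f)) → # (λ y → (v ∈? f) ×-dec (y ∈? X v)) (allFin n) ≤ 2 * r * 𝟙 d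
            each v (yes _) = ≤-trans (#-mono (λ y → (v ∈? f) ×-dec (y ∈? X v)) (_∈? X v) (allFin n) (λ _ → proj₂))
              (≤-trans (≤-reflexive (sym (∣∣≡# (X v)))) (≤-trans (Nearby.X≤ (near v)) (≤-reflexive (sym (*-identityʳ _)))))
            each v (no v∉) = ≤-trans (≤-reflexive (#-none (λ y → (v ∈? f) ×-dec (y ∈? X v)) (allFin n) (λ _ → v∉ ∘ proj₁))) z≤n

          -- Each edge is to lie in `C` and the set around it outside. The two are disjoint because
          -- the edge is not bad.
          split = separation E₂ id around (bits r)
            (λ {f} f∈ y∈f y∈ → let v , v∈f , y∈X = ∈⟪⟫⁻ (around? f) y∈ in
               proj₂ (∈-filter⁻ (¬? ∘ bad?) {xs = E₀} (E₂⊆E₁ f∈)) (v , v∈f , _ , x∈p∩q⁺ (y∈f , y∈X)))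
            (λ {f} f∈ → let size = unif (E₀⊆E (E₁⊆E₀ (E₂⊆E₁ f∈))) in
               +-mono-≤ (≤-reflexive size) (≤-trans (around-size f) (≤-reflexive (cong (_* (2 * r)) size))))

          C = proj₁ split
          sep? = separates? id around C
          E₃ = filter sep? E₂

          E₃⊆E₂ : ∀ {f} → f ∈ₗ E₃ → f ∈ₗ E₂
          E₃⊆E₂ f∈ = proj₁ (∈-filter⁻ sep? {xs = E₂} f∈)

          E₃⊆E₀ : ∀ {f} → f ∈ₗ E₃ → f ∈ₗ E₀
          E₃⊆E₀ = E₁⊆E₀ ∘ E₂⊆E₁ ∘ E₃⊆E₂

          dense₃ : δ′ * ∣ L ∣ < length E₃
          dense₃ = density-loss {2 * r} {2 ^ bits r} {δ′} {∣ L ∣} {length E₀} {length E₁} {length E₂} {length E₃} dense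
            (≤-trans (≤-reflexive (sym (#-∁ bad? E₀))) (+-mono-≤ badCount (≤-reflexive (sym (#-filter (¬? ∘ bad?) E₀)))))
            (≤-trans (proj₂ (proj₂ majority)) (*-monoʳ-≤ 2 (≤-reflexive (sym (#-filter (twice? t) E₁)))))
            (≤-trans (proj₂ split) (*-monoʳ-≤ (2 ^ bits r) (≤-reflexive (sym (#-filter sep? E₂)))))

          cleaned = minDegree δ′ L
            (unique-filter sep? (unique-filter (twice? t) (unique-filter (¬? ∘ bad?) (unique-filter (fresh? l) distinct))))
            (λ f∈ → fresh⊆layer l (E₃⊆E₀ f∈)) dense₃

          F = proj₁ cleaned

          F⊆E₃ : ∀ {f} → f ∈ₗ F → f ∈ₗ E₃
          F⊆E₃ = proj₁ (proj₂ (proj₂ cleaned))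

          F-outside : ∀ {h y} → h ∈ₗ F → y ∈ h → y ∉ U l
          F-outside h∈ y∈h = proj₂ (∈─⁻ (U (suc (suc l))) (U l) (fresh⊆layer l (E₃⊆E₀ (F⊆E₃ h∈)) y∈h))

          F-separated : ∀ {f} → f ∈ₗ F → f ⊆ C × ¬ Nonempty (around f ∩ C)
          F-separated f∈ = proj₂ (∈-filter⁻ sep? {xs = E₂} (F⊆E₃ f∈))

          -- The reason why one set `C` suffices: every surviving edge lies inside it and the
          -- vertices around every surviving edge lie outside, so conditions on single edges exclude
          -- conflicts between any two of them.
          F-apart : ∀ {f v} → f ∈ₗ F → v ∈ f → ∀ {h y} → h ∈ₗ F → y ∈ h → y ∉ X v
          F-apart {f} {v} f∈ v∈f h∈ y∈h y∈X = proj₂ (F-separated f∈)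
            (_ , x∈p∩q⁺ (∈⟪⟫⁺ (around? f) (v , v∈f , y∈X) , proj₁ (F-separated h∈) y∈h))

          pathFrom : ∀ {f v} j → j ≡ l ⊎ j ≡ suc l → f ∈ₗ F → v ∈ f → v ∈ layerSet j →
                     Σ[ p ∈ PrivatePath E F x v ] length (route p) ≡ j
          pathFrom {f} {v} j j≡ f∈ v∈f v∈ =
            privatise (proj₁ (Nearby.toX (near v) j j≡ (proj₁ split-v) (proj₂ split-v)))
                      (proj₂ (Nearby.toX (near v) j j≡ (proj₁ split-v) (proj₂ split-v)))
                      (F-apart f∈ v∈f) F-outside
            where
            split-v = ∈─⁻ (U (suc j)) (U j) v∈

          spot : Spot E x δ′ M
          spot = record
            { F = F ; distinct = proj₁ (proj₂ cleaned) ; F⊆E = E₀⊆E ∘ E₃⊆E₀ ∘ F⊆E₃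
            ; nonempty = proj₁ (proj₂ (proj₂ (proj₂ cleaned))) ; high = proj₂ (proj₂ (proj₂ (proj₂ cleaned)))
            ; access = λ f∈ v∈ → reach f∈ v∈ (level-of (fresh⊆layer l (E₃⊆E₀ (F⊆E₃ f∈)) v∈))
            ; level = t ; level≤ = t≤M t≡ ; target = layerSet t
            ; twice = λ f∈ → proj₂ (∈-filter⁻ (twice? t) {xs = E₁} (E₃⊆E₂ (F⊆E₃ f∈)))
            ; exact = λ f∈ v∈ → pathFrom t t≡ f∈ v∈ }
            where
            t≤M : ∀ {j} → j ≡ l ⊎ j ≡ suc l → j ≤ M
            t≤M (inj₁ refl) = <⇒≤ l<M
            t≤M (inj₂ refl) = l<M
            reach : ∀ {f v} → f ∈ₗ F → v ∈ f → v ∈ layerSet l ⊎ v ∈ layerSet (suc l) →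
                    Σ[ p ∈ PrivatePath E F x v ] length (route p) ≤ M
            reach f∈ v∈ (inj₁ h) = let p , eq = pathFrom l (inj₁ refl) f∈ v∈ h in p , ≤-trans (≤-reflexive eq) (<⇒≤ l<M)
            reach f∈ v∈ (inj₂ h) = let p , eq = pathFrom (suc l) (inj₂ refl) f∈ v∈ h in p , ≤-trans (≤-reflexive eq) l<M

      findSpot : Spot E x δ′ M
      findSpot with denseLayer {r = r} {D = D} e₀∈ x∈e₀ unif high M big
      ... | l , l<M , dense = Inside.spot l l<M dense

  -- Cycles through nested spots

  length-zero : ∀ {A : Set} {xs : List A} → length xs ≡ 0 → xs ≡ []
  length-zero {xs = []} _ = refl

  ∣⋃∣≤ : ∀ {n r} (es : List (Subset n)) → (∀ {e} → e ∈ₗ es → ∣ e ∣ ≡ r) → ∣ ⋃ es ∣ ≤ r * length es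
  ∣⋃∣≤ {n} []          unif = ≤-trans (≤-reflexive (∣⊥∣≡0 n)) z≤n
  ∣⋃∣≤ {r = r} (e ∷ es) unif = begin
    ∣ e ∪ ⋃ es ∣          ≤⟨ ∣∪∣≤ e (⋃ es) ⟩
    ∣ e ∣ + ∣ ⋃ es ∣      ≤⟨ +-mono-≤ (≤-reflexive (unif (here refl))) (∣⋃∣≤ es (unif ∘ there)) ⟩
    r + r * length es     ≡⟨ *-suc r (length es) ⟨
    r * suc (length es)   ∎
    where open ≤-Reasoning

  atLeastTwo : ∀ {n} {a b : Fin n} {es} → Path a es b → a ≢ b → (∀ {g} → g ∈ₗ es → a ∈ g → b ∉ g) → 2 ≤ length es
  atLeastTwo []                              a≢b apart = contradiction refl a≢b
  atLeastTwo (cons a∈ b∈ _ _ [])             a≢b apart = contradiction b∈ (apart (here refl) a∈)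
  atLeastTwo (cons _ _ _ _ (cons _ _ _ _ _)) a≢b apart = s≤s (s≤s z≤n)

  module _ {n r : ℕ} (r≥3 : 3 ≤ r) where

    freeEdge : ∀ {F : List (Subset n)} → Unique F → Lin F → ∀ {v} Y → v ∉ Y → ∣ Y ∣ < deg F v →
               ∃[ f ] f ∈ₗ F × v ∈ f × ¬ Nonempty (f ∩ Y)
    freeEdge {F} distinct lin {v} Y v∉ lt with any? (λ f → (v ∈? f) ×-dec ¬? (f ∼? Y)) F
    ... | yes found = let f , f∈ , w = find found in f , f∈ , w
    ... | no ∄ = contradiction (≤-<-trans (≤-trans
        (#-mono (v ∈?_) (λ f → (v ∈? f) ×-dec (f ∼? Y)) F meets) (meeting≤ distinct lin Y v∉)) lt) (<-irrefl refl)
      where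
      meets : ∀ {f} → f ∈ₗ F → v ∈ f → v ∈ f × Nonempty (f ∩ Y)
      meets {f} f∈ v∈ with f ∼? Y
      ... | yes m = v∈ , m
      ... | no ¬m = contradiction (lose f∈ (v∈ , ¬m)) ∄

    -- The path is stored from its growing end `tip` to the fixed vertex `z`. `edge` certifies that
    -- `tip` is a vertex of `F`, as the degree bound and the private path from `tip` require.
    record Tail (F : List (Subset n)) (T : Subset n) (z : Fin n) (t : ℕ) : Set where
      field
        {tip}    : Fin n
        steps    : List (Subset n)
        stepPath     : Path tip steps z
        len      : length steps ≡ t
        inF      : ∀ {f} → f ∈ₗ steps → f ∈ₗ F
        edge     : Subset n
        edge∈    : edge ∈ₗ F
        tip∈edge : tip ∈ edge
        tip∈T    : tip ∈ T

    greedyTail : ∀ {F : List (Subset n)} {T z f₀} k → Unique F → Lin F → (∀ {f} → f ∈ₗ F → ∣ f ∣ ≡ r) →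
                 (∀ {f v} → f ∈ₗ F → v ∈ f → r * k < deg F v) → (∀ {f} → f ∈ₗ F → 2 ≤ ∣ f ∩ T ∣) →
                 f₀ ∈ₗ F → z ∈ f₀ → ∀ t → t < k → Tail F T z (suc t)
    greedyTail {F} {T} {z} {f₀} k distinct lin unif high twice f₀∈ z∈ zero t< = record
      { steps = f₀ ∷ [] ; stepPath = single (proj₁ v∈) z∈ (proj₂ (proj₂ v)) ; len = refl ; inF = λ { (here refl) → f₀∈ }
      ; edge = f₀ ; edge∈ = f₀∈ ; tip∈edge = proj₁ v∈ ; tip∈T = proj₂ v∈ }
      where
      -- `z` need not lie in `T`; only the tips must. Two vertices of `f₀` in `T` leave one
      -- different from `z` in either case.
      v = another (f₀ ∩ T) (twice f₀∈) z
      v∈ = x∈p∩q⁻ f₀ T (proj₁ (proj₂ v))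
    greedyTail {F} {T} {z} k distinct lin unif high twice f₀∈ z∈ (suc t) t< = record
      { steps = proj₁ f ∷ steps ; stepPath = cons (proj₁ w∈) v∈f (proj₂ (proj₂ w)) only stepPath ; len = cong suc len
      ; inF = λ { (here refl) → f∈ ; (there g∈) → inF g∈ }
      ; edge = proj₁ f ; edge∈ = f∈ ; tip∈edge = proj₁ w∈ ; tip∈T = proj₂ w∈ }
      where
      open Tail (greedyTail k distinct lin unif high twice f₀∈ z∈ t (<⇒≤ t<)) renaming (tip to v)
      -- The next edge at `v` must avoid these vertices. There are at most `r * suc t ≤ r * k` of
      -- them, fewer than the degree of `v`.
      Y = ⋃ steps - v
      bound : ∣ Y ∣ < deg F v
      bound = begin-strict
        ∣ Y ∣               ≤⟨ p⊆q⇒∣p∣≤∣q∣ (p─q⊆p (⋃ steps) ⁅ v ⁆) ⟩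
        ∣ ⋃ steps ∣         ≤⟨ ∣⋃∣≤ steps (unif ∘ inF) ⟩
        r * length steps    ≡⟨ cong (r *_) len ⟩
        r * suc t           ≤⟨ *-monoʳ-≤ r (<⇒≤ t<) ⟩
        r * k               <⟨ high edge∈ tip∈edge ⟩
        deg F v             ∎
        where open ≤-Reasoning
      f = freeEdge distinct lin Y (λ v∈ → proj₂ (∈─⁻ (⋃ steps) ⁅ v ⁆ v∈) (x∈⁅x⁆ v)) bound
      f∈ = proj₁ (proj₂ f)
      v∈f = proj₁ (proj₂ (proj₂ f))
      w = another (proj₁ f ∩ T) (twice f∈) v
      w∈ = x∈p∩q⁻ (proj₁ f) T (proj₁ (proj₂ w))
      only : ∀ {g y} → g ∈ₗ steps → y ∈ proj₁ f → y ∈ g → y ≡ v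
      only {y = y} g∈ y∈f y∈g with y Fin.≟ v
      ... | yes eq = eq
      ... | no y≢v = contradiction (y , x∈p∩q⁺ (y∈f , x∈p∧x≢y⇒x∈p-y (∈⋃⁺ {es = steps} g∈ y∈g) y≢v)) (proj₂ (proj₂ (proj₂ f)))

    -- The first edge `g` of the outer path becomes the closing edge: the other outer edges followed
    -- by `ws` form a path from `c` through `b` to `z`, and `g` joins `z` to `c`.
    closeUp : ∀ (G : RGraph r n) {z b gs ws F} → (∀ {f} → f ∈ₗ F → f ∈ₗ edges G) → (∀ {g} → g ∈ₗ gs → g ∈ₗ edges G) →
              (∀ {w} → w ∈ₗ ws → w ∈ₗ F) → Path z gs b → Path b ws z → 2 ≤ length gs → 2 ≤ length ws →
              (∀ {g h y} → g ∈ₗ gs → h ∈ₗ F → y ∈ g → y ∈ h → y ≡ z ⊎ y ≡ b) →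
              ContainsLinearCycle G (length gs + length ws)
    closeUp G {z} {b} {g ∷ gs} {ws} {F} F⊆G gs⊆G ws⊆F R@(cons {c = c} z∈ c∈ z≢c only R′@(cons {es = gs′} _ _ _ _ _)) S len len′ cross =
      subst (ContainsLinearCycle G) size (lookup (g ∷ (gs ++ ws)) ,
        closedPath (≤-trans (s≤s z≤n) r≥3) (RGraph.uniform G ∘ inG)
          (append R′ S cross′) long c∈ z∈ only′ , λ i → inG (∈-lookup i))
      where
      inG : ∀ {f} → f ∈ₗ (g ∷ (gs ++ ws)) → f ∈ₗ edges G
      inG (here refl) = gs⊆G (here refl)
      inG (there f∈) = [ gs⊆G ∘ there , F⊆G ∘ ws⊆F ]′ (∈-++⁻ gs f∈)
      size : suc (length (gs ++ ws)) ≡ length (g ∷ gs) + length ws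
      size = cong suc (List.length-++ gs)
      long : 3 ≤ length (gs ++ ws)
      long = ≤-trans (+-mono-≤ (s≤s⁻¹ len) len′) (≤-reflexive (sym (List.length-++ gs)))
      cross′ : ∀ {e f y} → e ∈ₗ gs → f ∈ₗ ws → y ∈ e → y ∈ f → y ≡ b
      cross′ e∈ f∈ y∈e y∈f with cross (there e∈) (ws⊆F f∈) y∈e y∈f
      ... | inj₁ refl = contradiction y∈e (start-first R e∈)
      ... | inj₂ y≡b = y≡b
      only′ : ∀ {f y} → f ∈ₗ (gs ++ ws) → y ∈ g → y ∈ f → y ≡ c ⊎ y ≡ z
      only′ f∈ y∈g y∈f with ∈-++⁻ gs f∈
      ... | inj₁ f∈gs = inj₁ (only f∈gs y∈g y∈f)
      ... | inj₂ f∈ws with cross (here refl) (ws⊆F f∈ws) y∈g y∈f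
      ...   | inj₁ y≡z = inj₂ y≡z
      -- If `b` were on the first edge of the outer path, that edge would be the only one.
      ...   | inj₂ refl with () ← end-only-last R y∈g
    closeUp G _ _ _ (cons _ _ _ _ []) _ (s≤s ()) _ _

    module _ (G : RGraph r n) (lin : Lin (edges G)) where

      member : ∀ {f} → f ∈ₗ edges G → ∃[ v ] v ∈ f
      member {f} f∈ = ∣∣-∃ f (≤-trans (≤-trans (s≤s z≤n) r≥3) (≤-reflexive (sym (RGraph.uniform G f∈))))

      module TwoSpots {E : List (Subset n)} {x b : Fin n} {δ M k : ℕ} {h : Subset n} (E⊆G : ∀ {f} → f ∈ₗ E → f ∈ₗ edges G) (s₁ : Spot E x δ M)
                      (h∈ : h ∈ₗ Spot.F s₁) (b∈ : b ∈ h) (s₂ : Spot (Spot.F s₁) b (r * k) M) where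

        private
          module S₁ = Spot s₁
          module S₂ = Spot s₂

          S₁⊆G : ∀ {f} → f ∈ₗ S₁.F → f ∈ₗ edges G
          S₁⊆G = E⊆G ∘ S₁.F⊆E

          S₂⊆G : ∀ {f} → f ∈ₗ S₂.F → f ∈ₗ edges G
          S₂⊆G = S₁⊆G ∘ S₂.F⊆E

          -- Some vertex of the target differs from `b`, so its private path to `b` is not empty.
          -- This gives the inner paths the two edges that `closeUp` asks for.
          level>0 : 0 < S₂.level
          level>0 with S₂.nonempty
          ... | f , f∈ with another (f ∩ S₂.target) (S₂.twice f∈) b
          ...   | v , v∈ , v≢b with S₂.exact f∈ (proj₁ (x∈p∩q⁻ f S₂.target v∈)) (proj₂ (x∈p∩q⁻ f S₂.target v∈))
          ...     | p , len = n≢0⇒n>0 λ level≡0 → v≢b (empty-path (path p) (length-zero (trans len level≡0)))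

          root = S₂.nonempty

          z : Fin n
          z = proj₁ (member (S₂⊆G (proj₂ root)))

          z∈ : z ∈ proj₁ root
          z∈ = proj₂ (member (S₂⊆G (proj₂ root)))

          tail : ∀ t → t < k → Tail S₂.F S₂.target z (suc t)
          tail = greedyTail k S₂.distinct (λ e∈ f∈ → lin (S₂⊆G e∈) (S₂⊆G f∈)) (RGraph.uniform G ∘ S₂⊆G) S₂.high S₂.twice
                   (proj₂ root) z∈

          -- From `b` backwards along a private path to the tip, then along the tail to `z`. The
          -- private path meets the edges of the inner spot in the tip only, so the two parts can be
          -- appended.
          through : ∀ t → t < k → ∃[ ws ] Path b ws z × length ws ≡ S₂.level + suc t × (∀ {w} → w ∈ₗ ws → w ∈ₗ S₁.F)
          through t t< = reverse (route p) ++ Q.steps ,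
            append (reversePath (path p)) Q.stepPath (λ g∈ h∈ → onlyStart p (reverse-∈ _ g∈) (Q.inF h∈)) ,
            trans (List.length-++ (reverse (route p))) (cong₂ _+_ (trans (List.length-reverse (route p)) (proj₂ climb)) Q.len) ,
            λ w∈ → [ inE p ∘ reverse-∈ _ , S₂.F⊆E ∘ Q.inF ]′ (∈-++⁻ (reverse (route p)) w∈)
            where
            module Q = Tail (tail t t<)
            climb = S₂.exact Q.edge∈ Q.tip∈edge Q.tip∈T
            p = proj₁ climb

          z≢b : 0 < k → z ≢ b
          z≢b k>0 with through 0 k>0
          ... | []    , _ , len , _ = λ _ → 0≢1+n (trans len (+-suc S₂.level 0))
          ... | _ ∷ _ , S , _   , _ = start≢end S ∘ sym

          outer-z = S₁.access (S₂.F⊆E (proj₂ root)) z∈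
          outer-b = S₁.access h∈ b∈

          -- The private paths of `z` and `b` both end in `x` but may cross before. The result `gs`
          -- is the same for all `k` cycles.
          around = join lin (path (proj₁ outer-z)) (reversePath (path (proj₁ outer-b)))
                     (E⊆G ∘ inE (proj₁ outer-z)) (E⊆G ∘ inE (proj₁ outer-b) ∘ reverse-∈ _)

          gs = proj₁ around

          gs⊆ : ∀ {g} → g ∈ₗ gs → g ∈ₗ route (proj₁ outer-z) ⊎ g ∈ₗ reverse (route (proj₁ outer-b))
          gs⊆ = proj₂ (proj₂ (proj₂ around))

          gs⊆G : ∀ {g} → g ∈ₗ gs → g ∈ₗ edges G
          gs⊆G = [ E⊆G ∘ inE (proj₁ outer-z) , E⊆G ∘ inE (proj₁ outer-b) ∘ reverse-∈ _ ]′ ∘ gs⊆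

          z-or-b : ∀ {g} → g ∈ₗ gs → (∀ {f y} → f ∈ₗ S₁.F → y ∈ g → y ∈ f → y ≡ z) ⊎ (∀ {f y} → f ∈ₗ S₁.F → y ∈ g → y ∈ f → y ≡ b)
          z-or-b g∈ with gs⊆ g∈
          ... | inj₁ g∈z = inj₁ (λ f∈ → onlyStart (proj₁ outer-z) g∈z f∈)
          ... | inj₂ g∈b = inj₂ (λ f∈ → onlyStart (proj₁ outer-b) (reverse-∈ _ g∈b) f∈)

          cross : ∀ {g f y} → g ∈ₗ gs → f ∈ₗ S₁.F → y ∈ g → y ∈ f → y ≡ z ⊎ y ≡ b
          cross g∈ f∈ y∈g y∈f with z-or-b g∈
          ... | inj₁ only = inj₁ (only f∈ y∈g y∈f)
          ... | inj₂ only = inj₂ (only f∈ y∈g y∈f)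

          -- By `z-or-b`, an edge of `gs` meets the outer spot in `z` only or in `b` only. Hence
          -- `gs` has at least two edges.
          not-both : 0 < k → ∀ {g} → g ∈ₗ gs → z ∈ g → b ∉ g
          not-both k>0 g∈ z∈g b∈g with z-or-b g∈
          ... | inj₁ only = z≢b k>0 (sym (only h∈ b∈g b∈))
          ... | inj₂ only = z≢b k>0 (only (S₂.F⊆E (proj₂ root)) z∈g z∈)

        cycles : 0 < k → ∃[ a ] a ≤ suc (3 * M) × (∀ i → i < k → ContainsLinearCycle G (a + i))
        cycles k>0 = length gs + suc S₂.level , bound , λ i i<k →
          let ws , S , len , ws⊆ = through i i<k in
          subst (ContainsLinearCycle G)
            (trans (cong (length gs +_) (trans len (+-suc S₂.level i))) (sym (+-assoc (length gs) (suc S₂.level) i)))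
            (closeUp G S₁⊆G gs⊆G ws⊆ (proj₁ (proj₂ around)) S
              (atLeastTwo (proj₁ (proj₂ around)) (z≢b k>0) (not-both k>0))
              (≤-trans (+-mono-≤ level>0 (s≤s z≤n)) (≤-reflexive (sym len))) cross)
          where
          bound : length gs + suc S₂.level ≤ suc (3 * M)
          bound = begin
            length gs + suc S₂.level        ≤⟨ +-mono-≤ (proj₁ (proj₂ (proj₂ around))) (s≤s S₂.level≤) ⟩
            length (route (proj₁ outer-z)) + length (reverse (route (proj₁ outer-b))) + suc M
                                            ≡⟨ cong (λ m → length (route (proj₁ outer-z)) + m + suc M) (List.length-reverse (route (proj₁ outer-b))) ⟩
            length (route (proj₁ outer-z)) + length (route (proj₁ outer-b)) + suc M
                                            ≤⟨ +-monoˡ-≤ (suc M) (+-mono-≤ (proj₂ outer-z) (proj₂ outer-b)) ⟩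
            M + M + suc M                   ≡⟨ solve 1 (λ M → M :+ M :+ (con 1 :+ M) := con 1 :+ con 3 :* M) refl M ⟩
            suc (3 * M)                     ∎
            where
            open ≤-Reasoning
            open +-*-Solver

    consecutiveCycles : ∀ (G : RGraph r n) (lin : Lin (edges G)) (k δ₀ δ₁ M : ℕ) → 0 < k → δ₀ * n < length (edges G) →
      (2 * r * density r δ₁) ^ M * n < δ₀ ^ M → (2 * r * density r (r * k)) ^ M * n < δ₁ ^ M →
      ∃[ a ] a ≤ suc (3 * M) × (∀ i → i < k → ContainsLinearCycle G (a + i))
    consecutiveCycles G lin k δ₀ δ₁ M k>0 many big₁ big₂
      with minDegree δ₀ ⊤ (RGraph.unique G) (λ _ _ → ∈⊤) (≤-<-trans (*-monoʳ-≤ δ₀ (∣p∣≤n (⊤ {n}))) many)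
    ... | E , distinct , E⊆G , (e , e∈) , high with member G lin (E⊆G e∈)
    ...   | x , x∈ with findSpot r≥3 {δ = δ₀} {δ′ = δ₁} {M = M} e∈ x∈ distinct (λ e∈ f∈ → lin (E⊆G e∈) (E⊆G f∈)) (RGraph.uniform G ∘ E⊆G) high big₁
    ...     | s₁ with Spot.nonempty s₁
    ...       | h , h∈ with member G lin (E⊆G (Spot.F⊆E s₁ h∈))
    ...         | b , b∈ = TwoSpots.cycles G lin E⊆G s₁ h∈ b∈
        (findSpot r≥3 {δ = δ₁} {δ′ = r * k} {M = M} h∈ b∈ (Spot.distinct s₁) (λ e∈ f∈ → lin (E⊆G (Spot.F⊆E s₁ e∈)) (E⊆G (Spot.F⊆E s₁ f∈)))
          (RGraph.uniform G ∘ E⊆G ∘ Spot.F⊆E s₁) (Spot.high s₁) big₂) k>0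

  -- Choice of the minimum degrees

  isqrt : ∀ N → ∃[ y ] y * y ≤ N × N < suc y * suc y
  isqrt zero    = 0 , z≤n , s≤s z≤n
  isqrt (suc N) with isqrt N
  ... | y , lo , hi with suc N <? suc y * suc y
  ...   | yes lt = y , m≤n⇒m≤1+n lo , lt
  ...   | no ≮   = suc y , ≮⇒≥ ≮ , ≤-<-trans hi (*-mono-< (n<1+n (suc y)) (n<1+n (suc y)))

  ^-distribʳ-* : ∀ m a b → (a * b) ^ m ≡ a ^ m * b ^ m
  ^-distribʳ-* zero    a b = refl
  ^-distribʳ-* (suc m) a b = trans (cong (a * b *_) (^-distribʳ-* m a b)) ([m*n]*[o*p]≡[m*o]*[n*p] a b (a ^ m) (b ^ m))

  ^-cancelʳ-≤ : ∀ m {a b} → 0 < m → a ^ m ≤ b ^ m → a ≤ b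
  ^-cancelʳ-≤ (suc m) _ le = ≮⇒≥ λ b<a → <-irrefl refl (<-≤-trans (strict m b<a) le)
    where
    strict : ∀ m {a b} → b < a → b ^ suc m < a ^ suc m
    strict zero    {a} {b} lt = subst₂ _<_ (sym (*-identityʳ b)) (sym (*-identityʳ a)) lt
    strict (suc m) lt = *-mono-< lt (strict m lt)

  square-^ : ∀ a m → a ^ (2 * m) ≡ (a * a) ^ m
  square-^ a m = trans (sym (^-*-assoc a 2 m)) (cong (λ b → (a * b) ^ m) (*-identityʳ a))

  -- The loss factor of one spot: for `δ > 0` the additive `2 * r` in `density r δ` is absorbed into
  -- a multiple of `δ`.
  scale : ℕ → ℕ
  scale r = 2 * r * (2 * r + 2 * 2 ^ bits r)

  -- Two spots cost `scale r` twice, `4` pays for rounding the square root, `r` for the inner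
  -- minimum degree `r * k`, and `suc` for a strict inequality.
  spread : ℕ → ℕ
  spread r = suc (4 * (scale r * scale r) * r)

  module _ (r : ℕ) (r≥3 : 3 ≤ r) where

    density≤ : ∀ δ → 0 < δ → 2 * r * density r δ ≤ scale r * δ
    density≤ δ δ>0 = begin
      2 * r * (2 * r + p * δ)         ≤⟨ *-monoʳ-≤ (2 * r) (+-monoˡ-≤ (p * δ) (m≤m*n (2 * r) δ {{>-nonZero δ>0}})) ⟩
      2 * r * (2 * r * δ + p * δ)     ≡⟨ cong (2 * r *_) (*-distribʳ-+ δ (2 * r) p) ⟨
      2 * r * ((2 * r + p) * δ)       ≡⟨ *-assoc (2 * r) _ δ ⟨
      2 * r * (2 * r + p) * δ         ∎
      where
      open ≤-Reasoning
      p = 2 * 2 ^ bits r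

    -- With `y ≈ √(δ δ₂)`, both `δ / y` and `y / δ₂` are about `√(δ / δ₂)`. Their powers with
    -- exponent `2 * m` are about `(δ / δ₂) ^ m`, which `gap` compares with `n`; hence the doubled
    -- radius.
    intermediate : ∀ {n m δ δ₂} → 0 < δ → 0 < δ₂ → (4 * (scale r * scale r) * δ₂) ^ m * n < δ ^ m →
                   ∃[ y ] (2 * r * density r y) ^ (2 * m) * n < δ ^ (2 * m) × (2 * r * density r δ₂) ^ (2 * m) * n < y ^ (2 * m)
    intermediate {n} {m} {δ} {δ₂} δ>0 δ₂>0 gap with isqrt (δ * δ₂)
    ... | zero , lo , hi = contradiction (≤-<-trans (*-mono-≤ δ>0 δ₂>0) hi) (<-irrefl refl)
    ... | y@(suc _) , lo , hi = y , first , second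
      where
      open ≤-Reasoning
      q = scale r
      instance
        δ^m≢0 : NonZero (δ ^ m)
        δ^m≢0 = m^n≢0 δ m {{>-nonZero δ>0}}
        δ₂^m≢0 : NonZero (δ₂ ^ m)
        δ₂^m≢0 = m^n≢0 δ₂ m {{>-nonZero δ₂>0}}
      first : (2 * r * density r y) ^ (2 * m) * n < δ ^ (2 * m)
      first = begin-strict
        (2 * r * density r y) ^ (2 * m) * n    ≤⟨ *-monoˡ-≤ n (^-monoˡ-≤ (2 * m) (density≤ y (s≤s z≤n))) ⟩
        (q * y) ^ (2 * m) * n                  ≡⟨ cong (_* n) (trans (square-^ (q * y) m) (cong (_^ m) ([m*n]*[o*p]≡[m*o]*[n*p] q y q y))) ⟩
        (q * q * (y * y)) ^ m * n              ≤⟨ *-monoˡ-≤ n (^-monoˡ-≤ m (*-monoʳ-≤ (q * q) lo)) ⟩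
        (q * q * (δ * δ₂)) ^ m * n             ≡⟨ cong (λ a → a ^ m * n) (solve 3 (λ q d e → q :* (d :* e) := q :* e :* d) refl (q * q) δ δ₂) ⟩
        (q * q * δ₂ * δ) ^ m * n               ≡⟨ cong (_* n) (^-distribʳ-* m (q * q * δ₂) δ) ⟩
        (q * q * δ₂) ^ m * δ ^ m * n           ≡⟨ solve 3 (λ a b c → a :* b :* c := a :* c :* b) refl ((q * q * δ₂) ^ m) (δ ^ m) n ⟩
        (q * q * δ₂) ^ m * n * δ ^ m           ≤⟨ *-monoˡ-≤ (δ ^ m) (*-monoˡ-≤ n (^-monoˡ-≤ m (*-monoˡ-≤ δ₂ (m≤n*m (q * q) 4)))) ⟩
        (4 * (q * q) * δ₂) ^ m * n * δ ^ m     <⟨ *-monoˡ-< (δ ^ m) gap ⟩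
        δ ^ m * δ ^ m                          ≡⟨ ^-distribʳ-* m δ δ ⟨
        (δ * δ) ^ m                            ≡⟨ square-^ δ m ⟨
        δ ^ (2 * m)                            ∎
        where open +-*-Solver
      -- The cost of rounding down: `suc y ≤ 2 * y` because `y ≥ 1`.
      near : δ * δ₂ ≤ 4 * (y * y)
      near = begin
        δ * δ₂                 ≤⟨ <⇒≤ hi ⟩
        suc y * suc y          ≤⟨ *-mono-≤ double double ⟩
        (2 * y) * (2 * y)      ≡⟨ [m*n]*[o*p]≡[m*o]*[n*p] 2 y 2 y ⟩
        4 * (y * y)            ∎
        where
        double : suc y ≤ 2 * y
        double = ≤-trans (+-monoˡ-≤ y (s≤s z≤n)) (≤-reflexive (cong (y +_) (sym (+-identityʳ y))))
      second : (2 * r * density r δ₂) ^ (2 * m) * n < y ^ (2 * m)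
      second = *-cancelˡ-< (4 ^ m) _ _ (begin-strict
        4 ^ m * ((2 * r * density r δ₂) ^ (2 * m) * n)   ≤⟨ *-monoʳ-≤ (4 ^ m) (*-monoˡ-≤ n (^-monoˡ-≤ (2 * m) (density≤ δ₂ δ₂>0))) ⟩
        4 ^ m * ((q * δ₂) ^ (2 * m) * n)                 ≡⟨ cong (λ a → 4 ^ m * (a * n)) (square-^ (q * δ₂) m) ⟩
        4 ^ m * ((q * δ₂ * (q * δ₂)) ^ m * n)            ≡⟨ *-assoc (4 ^ m) _ n ⟨
        4 ^ m * (q * δ₂ * (q * δ₂)) ^ m * n              ≡⟨ cong (_* n) (^-distribʳ-* m 4 _) ⟨
        (4 * (q * δ₂ * (q * δ₂))) ^ m * n                ≡⟨ cong (λ a → a ^ m * n) (solve 2 (λ q d → con 4 :* (q :* d :* (q :* d)) := con 4 :* (q :* q) :* d :* d) refl q δ₂) ⟩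
        (4 * (q * q) * δ₂ * δ₂) ^ m * n                  ≡⟨ cong (_* n) (^-distribʳ-* m _ δ₂) ⟩
        (4 * (q * q) * δ₂) ^ m * δ₂ ^ m * n              ≡⟨ solve 3 (λ a b c → a :* b :* c := a :* c :* b) refl ((4 * (q * q) * δ₂) ^ m) (δ₂ ^ m) n ⟩
        (4 * (q * q) * δ₂) ^ m * n * δ₂ ^ m              <⟨ *-monoˡ-< (δ₂ ^ m) gap ⟩
        δ ^ m * δ₂ ^ m                                   ≡⟨ ^-distribʳ-* m δ δ₂ ⟨
        (δ * δ₂) ^ m                                     ≤⟨ ^-monoˡ-≤ m near ⟩
        (4 * (y * y)) ^ m                                ≡⟨ ^-distribʳ-* m 4 (y * y) ⟩
        4 ^ m * (y * y) ^ m                              ≡⟨ cong (4 ^ m *_) (square-^ y m) ⟨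
        4 ^ m * y ^ (2 * m)                              ∎)
        where open +-*-Solver

    -- `δ` is the quotient of `e - 1`, not of `e`, by `n`, which makes `δ * n < e` strict. As
    -- `2 * n ≤ e`, it is at least `1`, so rounding costs at most a factor `2`.
    baseDegree : ∀ n e .{{_ : NonZero n}} → 2 * n ≤ e → ∃[ δ ] 0 < δ × δ * n < e × e ≤ 2 * δ * n
    baseDegree n (suc e) 2n≤ = δ , δ>0 , s≤s (m/n*n≤m e n) , upper
      where
      open ≤-Reasoning
      δ = e / n
      above : suc e ≤ suc δ * n
      above = begin-strict
        e                     ≡⟨ m≡m%n+[m/n]*n e n ⟩
        e % n + δ * n         <⟨ +-monoˡ-< (δ * n) (m%n<n e n) ⟩
        suc δ * n             ∎
      δ>0 : 0 < δ
      δ>0 = s≤s⁻¹ (*-cancelʳ-≤ 2 (suc δ) n (≤-trans 2n≤ above))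
      upper : suc e ≤ 2 * δ * n
      upper = ≤-trans above (*-monoˡ-≤ n (≤-trans (+-monoˡ-≤ δ δ>0) (≤-reflexive (cong (δ +_) (sym (+-identityʳ δ))))))
    baseDegree (suc n) zero ()

    -- With `d` the average degree, the last hypothesis is `n ≤ (d / (2 * r * spread r * k)) ^ m`
    -- cleared of denominators. The `2 * r` is the loss from `d` to `δ ≥ d / (2 * r)`.
    manyCycles : ∀ {n} .{{_ : NonZero n}} (G : RGraph r n) → Lin (edges G) → ∀ k m → 0 < k → 0 < m →
                 (2 * r * spread r * k * n) ^ m * n ≤ (r * length (edges G)) ^ m →
                 ∃[ a ] a ≤ suc (3 * (2 * m)) × (∀ i → i < k → ContainsLinearCycle G (a + i))
    manyCycles {n} G lin k m k>0 m>0 hyp = consecutiveCycles r≥3 G lin k δ (proj₁ mid) (2 * m) k>0 δn<e (proj₁ (proj₂ mid)) (proj₂ (proj₂ mid))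
      where
      open ≤-Reasoning
      e = length (edges G)
      instance
        r≢0 : NonZero r
        r≢0 = >-nonZero (≤-trans (s≤s z≤n) r≥3)
        k≢0 : NonZero k
        k≢0 = >-nonZero k>0
        rn^m≢0 : NonZero ((2 * r * n) ^ m)
        rn^m≢0 = m^n≢0 (2 * r * n) m {{m*n≢0 (2 * r) n {{m*n≢0 2 r}}}}
      dense : 2 * n ≤ e
      dense = *-cancelˡ-≤ r (begin
        r * (2 * n)                  ≡⟨ solve 2 (λ r n → r :* (con 2 :* n) := con 2 :* r :* n) refl r n ⟩
        2 * r * n                    ≤⟨ *-monoˡ-≤ n (m≤m*n (2 * r) (spread r)) ⟩
        2 * r * spread r * n           ≤⟨ *-monoˡ-≤ n (m≤m*n (2 * r * spread r) k) ⟩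
        2 * r * spread r * k * n       ≤⟨ ^-cancelʳ-≤ m m>0 (≤-trans (m≤m*n _ n) hyp) ⟩
        r * e                        ∎)
        where open +-*-Solver
      base = baseDegree n e dense
      δ = proj₁ base
      δn<e = proj₁ (proj₂ (proj₂ base))
      gap : (spread r * k) ^ m * n ≤ δ ^ m
      gap = *-cancelˡ-≤ ((2 * r * n) ^ m) (begin
        (2 * r * n) ^ m * ((spread r * k) ^ m * n)     ≡⟨ *-assoc ((2 * r * n) ^ m) _ n ⟨
        (2 * r * n) ^ m * (spread r * k) ^ m * n       ≡⟨ cong (_* n) (^-distribʳ-* m (2 * r * n) (spread r * k)) ⟨
        (2 * r * n * (spread r * k)) ^ m * n           ≡⟨ cong (λ a → a ^ m * n) (solve 4 (λ r n s k → con 2 :* r :* n :* (s :* k) := con 2 :* r :* s :* k :* n) refl r n (spread r) k) ⟩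
        (2 * r * spread r * k * n) ^ m * n             ≤⟨ hyp ⟩
        (r * e) ^ m                                  ≤⟨ ^-monoˡ-≤ m (*-monoʳ-≤ r (proj₂ (proj₂ (proj₂ base)))) ⟩
        (r * (2 * δ * n)) ^ m                        ≡⟨ cong (_^ m) (solve 3 (λ r d n → r :* (con 2 :* d :* n) := con 2 :* r :* n :* d) refl r δ n) ⟩
        (2 * r * n * δ) ^ m                          ≡⟨ ^-distribʳ-* m (2 * r * n) δ ⟩
        (2 * r * n) ^ m * δ ^ m                      ∎)
        where open +-*-Solver
      strictly : ∀ m → 0 < m → (4 * (scale r * scale r) * (r * k)) ^ m < (spread r * k) ^ m
      strictly m m>0 = ≰⇒> λ le → <-irrefl refl (≤-<-trans (^-cancelʳ-≤ m m>0 le) (begin-strict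
        4 * (scale r * scale r) * (r * k)         ≡⟨ *-assoc (4 * (scale r * scale r)) r k ⟨
        4 * (scale r * scale r) * r * k           <⟨ *-monoˡ-< k (n<1+n (4 * (scale r * scale r) * r)) ⟩
        spread r * k                            ∎))
      mid = intermediate {n} {m} {δ} {r * k} (proj₁ (proj₂ base)) (>-nonZero⁻¹ (r * k) {{m*n≢0 r k}})
              (<-≤-trans (*-monoˡ-< n (strictly m m>0)) gap)

  -- Linearity of the given hypergraph, and powers of two in place of real logarithms

  linear⇒Lin : ∀ {r n} (G : RGraph r n) → Linear G → Lin (edges G)
  linear⇒Lin G linear {e} {f} e∈ f∈ {x} {y} x≢y x∈e y∈e x∈f y∈f with Vec.≡-dec Bool._≟_ e f
  ... | yes e≡f = e≡f
  ... | no  e≢f = contradiction (begin-strict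
    1                          <⟨ ≤-reflexive (sym (cong₂ _+_ (∣⁅x⁆∣≡1 x) (∣⁅x⁆∣≡1 y))) ⟩
    ∣ ⁅ x ⁆ ∣ + ∣ ⁅ y ⁆ ∣      ≤⟨ ∣∪∣-disjoint ⁅ x ⁆ ⁅ y ⁆ (λ z∈ z∈′ → x≢y (trans (sym (x∈⁅y⁆⇒x≡y x z∈)) (x∈⁅y⁆⇒x≡y y z∈′))) ⟩
    ∣ ⁅ x ⁆ ∪ ⁅ y ⁆ ∣          ≤⟨ p⊆q⇒∣p∣≤∣q∣ (λ z∈ → case x∈p∪q⁻ ⁅ x ⁆ ⁅ y ⁆ z∈ of λ
                                    { (inj₁ h) → subst (_∈ e ∩ f) (sym (x∈⁅y⁆⇒x≡y x h)) (x∈p∩q⁺ (x∈e , x∈f))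
                                    ; (inj₂ h) → subst (_∈ e ∩ f) (sym (x∈⁅y⁆⇒x≡y y h)) (x∈p∩q⁺ (y∈e , y∈f)) }) ⟩
    ∣ e ∩ f ∣                  ≤⟨ linear e∈ f∈ e≢f ⟩
    1                          ∎) (<-irrefl refl)
    where open ≤-Reasoning

  n<2^n : ∀ n → n < 2 ^ n
  n<2^n zero    = s≤s z≤n
  n<2^n (suc n) = +-mono-≤ (m^n>0 2 n) (≤-trans (n<2^n n) (m≤m+n (2 ^ n) 0))

  -- `s` is the integer part of the logarithm of `u / v`; the search descends from the exponent `u`,
  -- which is large enough by `n<2^n`.
  log₂-floor : ∀ u v → 0 < v → v ≤ u → ∃[ s ] 2 ^ s * v ≤ u × u < 2 ^ suc s * v
  log₂-floor u v v>0 v≤u = search u (<-≤-trans (n<2^n u) (m≤m*n (2 ^ u) v {{>-nonZero v>0}}))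
    where
    search : ∀ f → u < 2 ^ f * v → ∃[ s ] 2 ^ s * v ≤ u × u < 2 ^ suc s * v
    search zero    lt = contradiction (≤-<-trans v≤u (<-≤-trans lt (≤-reflexive (+-identityʳ v)))) (<-irrefl refl)
    search (suc f) lt with u <? 2 ^ f * v
    ... | yes lt′ = search f lt′
    ... | no ≮    = f , ≮⇒≥ ≮ , lt

  abstract
    -- A crude integer bound for the logarithm of `2 * r * spread r`. Replacing that constant by a
    -- power of two lets it be subtracted from exponents.
    logSpread : ℕ → ℕ
    logSpread r = 2 * r * spread r

    spread≤ : ∀ r → 2 * r * spread r ≤ 2 ^ logSpread r
    spread≤ r = <⇒≤ (n<2^n (2 * r * spread r))

  module _ {r n : ℕ} .{{_ : NonZero n}} (r≥3 : 3 ≤ r) (G : RGraph r n) where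

    edge⇒1<n : 0 < r * length (edges G) → 1 < n
    edge⇒1<n pos with edges G | RGraph.uniform G
    ... | []    | _    = contradiction (subst (0 <_) (*-zeroʳ r) pos) λ ()
    ... | e ∷ _ | unif = ≤-trans (≤-trans (n≤1+n 2) r≥3) (≤-trans (≤-reflexive (sym (unif (here refl)))) (∣p∣≤n e))

    -- With `d` the average degree, `2 ^ s` is at most `d / k` divided by the constant loss, and its
    -- power with exponent `m` is at least `n`. Multiplying out gives the hypothesis of
    -- `manyCycles`.
    cyclesBelow : Linear G → ∀ k m s → 0 < k → 0 < m → n ≤ 2 ^ (m * s) →
                  2 ^ s * (2 ^ logSpread r * (n * k)) ≤ r * length (edges G) →
                  ∃[ a ] a ≤ 6 * m + 6 × (∀ i → i < k → ContainsLinearCycle G (a + i))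
    cyclesBelow linear k m s k>0 m>0 n≤ dense = proj₁ found , ≤-trans (proj₁ (proj₂ found)) bound , proj₂ (proj₂ found)
      where
      open ≤-Reasoning
      large : (2 * r * spread r * k * n) ^ m * n ≤ (r * length (edges G)) ^ m
      large = begin
        (2 * r * spread r * k * n) ^ m * n               ≤⟨ *-mono-≤ (^-monoˡ-≤ m (*-monoˡ-≤ n (*-monoˡ-≤ k (spread≤ r)))) n≤ ⟩
        (2 ^ logSpread r * k * n) ^ m * 2 ^ (m * s)      ≡⟨ cong₂ (λ a b → a ^ m * b) (trans (*-assoc (2 ^ logSpread r) k n) (cong (2 ^ logSpread r *_) (*-comm k n)))
                                                              (trans (cong (2 ^_) (*-comm m s)) (sym (^-*-assoc 2 s m))) ⟩
        (2 ^ logSpread r * (n * k)) ^ m * (2 ^ s) ^ m    ≡⟨ ^-distribʳ-* m (2 ^ logSpread r * (n * k)) (2 ^ s) ⟨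
        (2 ^ logSpread r * (n * k) * 2 ^ s) ^ m          ≡⟨ cong (_^ m) (*-comm (2 ^ logSpread r * (n * k)) (2 ^ s)) ⟩
        (2 ^ s * (2 ^ logSpread r * (n * k))) ^ m        ≤⟨ ^-monoˡ-≤ m dense ⟩
        (r * length (edges G)) ^ m                       ∎
      found : ∃[ a ] a ≤ suc (3 * (2 * m)) × (∀ i → i < k → ContainsLinearCycle G (a + i))
      found = manyCycles r r≥3 G (linear⇒Lin G linear) k m k>0 m>0 large
      bound : suc (3 * (2 * m)) ≤ 6 * m + 6
      bound = begin
        suc (3 * (2 * m))      ≡⟨ cong suc (*-assoc 3 2 m) ⟨
        suc (6 * m)            ≡⟨ +-comm 1 (6 * m) ⟩
        6 * m + 1              ≤⟨ +-monoʳ-≤ (6 * m) (s≤s z≤n) ⟩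
        6 * m + 6              ∎

-- Logarithms as cuts, and the integer bounds that they imply

module Logarithms where

  open import Data.Integer.Base as ℤ using (ℤ; +_; -[1+_])
  import Data.Integer.Properties as ℤ
  open import Data.List.Base using (length)
  open import Data.Nat.Base as ℕ using (ℕ; zero; suc; NonZero)
  import Data.Nat.Properties as ℕ
  open import Data.Product.Base using (_×_; _,_; Σ-syntax; ∃-syntax; proj₁; proj₂)
  open import Data.Rational.Unnormalised.Base as ℚᵘ
    using (ℚᵘ; _/_; _*_; _+_; _<_; _≤_; _≃_; *≡*; *≤*; *<*; 0ℚᵘ)
  import Data.Rational.Unnormalised.Properties as ℚᵘ
  open import Relation.Binary.PropositionalEquality
  open import Relation.Nullary using (¬_; contradiction)

  open import Algebra.Definitions.RawSemiring ℚᵘ.+-*-rawSemiring using (_^_)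
  open import Defs
  open Combinatorics using (logSpread; edge⇒1<n; cyclesBelow; log₂-floor)

  fraction-< : ∀ {a c} b d .{{_ : NonZero b}} .{{_ : NonZero d}} → a ℕ.* d ℕ.< c ℕ.* b → + a / b < + c / d
  fraction-< {a} {c} (suc b) (suc d) lt = *<* (subst₂ ℤ._<_ (ℤ.pos-* a (suc d)) (ℤ.pos-* c (suc b)) (ℤ.+<+ lt))

  fraction-≤ : ∀ {a c} b d .{{_ : NonZero b}} .{{_ : NonZero d}} → a ℕ.* d ℕ.≤ c ℕ.* b → + a / b ≤ + c / d
  fraction-≤ {a} {c} (suc b) (suc d) le = *≤* (subst₂ ℤ._≤_ (ℤ.pos-* a (suc d)) (ℤ.pos-* c (suc b)) (ℤ.+≤+ le))

  fraction-≤⁻ : ∀ {a c} b d .{{_ : NonZero b}} .{{_ : NonZero d}} → + a / b ≤ + c / d → a ℕ.* d ℕ.≤ c ℕ.* b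
  fraction-≤⁻ {a} {c} (suc b) (suc d) (*≤* le) =
    ℤ.drop‿+≤+ (subst₂ ℤ._≤_ (sym (ℤ.pos-* a (suc d))) (sym (ℤ.pos-* c (suc b))) le)

  fraction-* : ∀ a c b d .{{_ : NonZero b}} .{{_ : NonZero d}} → (+ a / b) * (+ c / d) ≃ (_/_ (+ (a ℕ.* c)) (b ℕ.* d) {{ℕ.m*n≢0 b d}})
  fraction-* a c (suc b) (suc d) = *≡* (cong (ℤ._* + (suc b ℕ.* suc d)) (sym (ℤ.pos-* a c)))

  fraction-*-int : ∀ a c → (+ a / 1) * (+ c / 1) ≃ + (a ℕ.* c) / 1
  fraction-*-int a c = fraction-* a c 1 1

  fraction-+-int : ∀ a c → (+ a / 1) + (+ c / 1) ≃ + (a ℕ.+ c) / 1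
  fraction-+-int a c = *≡* (cong (ℤ._* + 1) (trans (cong₂ ℤ._+_ (ℤ.*-identityʳ (+ a)) (ℤ.*-identityʳ (+ c))) (sym (ℤ.pos-+ a c))))

  power-2 : ∀ a → 2^ (+ a) ≃ + (2 ℕ.^ a) / 1
  power-2 zero    = ℚᵘ.≃-refl
  power-2 (suc a) = ℚᵘ.≃-trans (ℚᵘ.*-congˡ {+ 2 / 1} (power-2 a)) (fraction-*-int 2 (2 ℕ.^ a))

  below-log₂ : ∀ a {u} v .{{_ : NonZero v}} {x} → x ≃ + u / v → 2 ℕ.^ a ℕ.* v ℕ.< u → lower (log₂ x) (+ a / 1)
  below-log₂ a {u} v {x} x≃ lt = begin-strict
    2^ (+ a)            ≃⟨ power-2 a ⟩
    + (2 ℕ.^ a) / 1     <⟨ fraction-< 1 v (subst (2 ℕ.^ a ℕ.* v ℕ.<_) (sym (ℕ.*-identityʳ u)) lt) ⟩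
    + u / v             ≃⟨ x≃ ⟨
    x                   ≃⟨ ℚᵘ.*-identityʳ x ⟨
    x ^ 1               ∎
    where open ℚᵘ.≤-Reasoning

  above-log₂ : ∀ a {u} v .{{_ : NonZero v}} {x} → x ≃ + u / v → u ℕ.< 2 ℕ.^ a ℕ.* v → upper (log₂ x) (+ a / 1)
  above-log₂ a {u} v {x} x≃ lt = begin-strict
    x ^ 1               ≃⟨ ℚᵘ.*-identityʳ x ⟩
    x                   ≃⟨ x≃ ⟩
    + u / v             <⟨ fraction-< v 1 (subst (ℕ._< 2 ℕ.^ a ℕ.* v) (sym (ℕ.*-identityʳ u)) lt) ⟩
    + (2 ℕ.^ a) / 1     ≃⟨ power-2 a ⟨
    2^ (+ a)            ∎
    where open ℚᵘ.≤-Reasoning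

  module _ (x : ℚᵘ) (u v g : ℕ) .{{_ : NonZero v}} (x≃ : x ≃ + u / v) where

    -- Of the two units above `g`, one rounds the logarithm up to the integer `suc (s + g)`, and the
    -- other leaves room for the integer witness `suc g` strictly below `c₂`.
    c₂ : ℚᵘ
    c₂ = + (2 ℕ.+ g) / 1

    positive : 2 ℕ.^ (3 ℕ.+ g) ℕ.* v ℕ.< u → Positive (log₂ x - fromℚ c₂)
    positive lt = + (3 ℕ.+ g) / 1 , + (3 ℕ.+ g) / 1 , below-log₂ (3 ℕ.+ g) v x≃ lt ,
      fraction-< 1 1 (ℕ.*-monoˡ-< 1 (ℕ.n<1+n (2 ℕ.+ g))) , ℚᵘ.≤-reflexive (ℚᵘ.+-identityˡ (+ (3 ℕ.+ g) / 1))

    upperBound : ∀ s → u ℕ.< 2 ℕ.^ suc (s ℕ.+ g) ℕ.* v → upper (log₂ x - fromℚ c₂) (+ s / 1)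
    upperBound s lt = + suc (s ℕ.+ g) / 1 , + suc g / 1 , above-log₂ (suc (s ℕ.+ g)) v x≃ lt ,
      fraction-< 1 1 (ℕ.*-monoˡ-< 1 (ℕ.n<1+n (1 ℕ.+ g))) ,
      ℚᵘ.≤-reflexive (ℚᵘ.≃-trans (ℚᵘ.≃-reflexive (cong (λ a → + a / 1) (sym (ℕ.+-suc s g)))) (ℚᵘ.≃-sym (fraction-+-int s (suc g))))

    -- 0 and s enclose the denominator, so a ≥ max 0 (m s) with 2 ^ a < n shows m < log₂ n ÷ (log₂ x - c₂).
    notCeiling : ∀ {n} .{{_ : NonZero n}} (pos : Positive (log₂ x - fromℚ c₂)) s a {m} → u ℕ.< 2 ℕ.^ suc (s ℕ.+ g) ℕ.* v →
                 2 ℕ.^ a ℕ.< n → (m / 1) * (+ s / 1) ≤ + a / 1 →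
                 lower (log₂ (+ n / 1) ÷ (log₂ x - fromℚ c₂) [ pos ]) (m / 1)
    notCeiling {n} pos s a {m} lt 2^a<n le = + a / 1 , 0ℚᵘ , + s / 1 ,
      below-log₂ a 1 ℚᵘ.≃-refl (subst (ℕ._< n) (sym (ℕ.*-identityʳ (2 ℕ.^ a))) 2^a<n) , pos , upperBound s lt ,
      ℚᵘ.≤-trans (ℚᵘ.≤-reflexive (ℚᵘ.*-zeroʳ (m / 1))) (fraction-≤ 1 1 ℕ.z≤n) , le

    -- The quotient is positive because `1 < n`, which excludes `m ≤ 0`. For positive `m`, since `s`
    -- exceeds the denominator, `2 ^ (m * s) < n` would put the quotient above `m`.
    ceiling-pos : ∀ {n} .{{_ : NonZero n}} (pos : Positive (log₂ x - fromℚ c₂)) s {m} → u ℕ.< 2 ℕ.^ suc (s ℕ.+ g) ℕ.* v → 1 ℕ.< n →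
                  ¬ lower (log₂ (+ n / 1) ÷ (log₂ x - fromℚ c₂) [ pos ]) (m / 1) →
                  ∃[ m′ ] m ≡ + suc m′ × n ℕ.≤ 2 ℕ.^ (suc m′ ℕ.* s)
    ceiling-pos pos s {+ zero} lt n>1 not =
      contradiction (notCeiling pos s 0 {+ 0} lt n>1 (ℚᵘ.≤-reflexive (ℚᵘ.*-zeroˡ (+ s / 1)))) not
    ceiling-pos pos s { -[1+ m ]} lt n>1 not =
      contradiction (notCeiling pos s 0 { -[1+ m ]} lt n>1 (nonpositive s)) not
      where
      nonpositive : ∀ s → (-[1+ m ] / 1) * (+ s / 1) ≤ + 0 / 1
      nonpositive zero    = ℚᵘ.≤-reflexive (ℚᵘ.*-zeroʳ (-[1+ m ] / 1))
      nonpositive (suc s) = *≤* ℤ.-≤+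
    ceiling-pos {n} pos s {+ suc m} lt n>1 not = m , refl , ℕ.≮⇒≥ λ small →
      not (notCeiling pos s (suc m ℕ.* s) {+ suc m} lt small (ℚᵘ.≤-reflexive (fraction-*-int (suc m) s)))

  module _ {r n k : ℕ} .{{_ : NonZero n}} .{{_ : NonZero k}} (r≥3 : 3 ℕ.≤ r) (G : RGraph r n) (linear : Linear G)
           (dense : (+ (2 ℕ.^ (4 ℕ.+ logSpread r)) / 1) * (+ k / 1) ≤ avgDegree G) where

    private
      g = logSpread r
      u = r ℕ.* length (edges G)
      x = avgDegree G * (+ 1 / k)

      instance
        nk≢0 : NonZero (n ℕ.* k)
        nk≢0 = ℕ.m*n≢0 n k

      x≃ : x ≃ + u / (n ℕ.* k)
      x≃ = subst (λ a → x ≃ + a / (n ℕ.* k)) (ℕ.*-identityʳ u) (fraction-* u 1 n k)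

      dense′ : 2 ℕ.^ (4 ℕ.+ g) ℕ.* (n ℕ.* k) ℕ.≤ u
      dense′ = subst₂ ℕ._≤_ (trans (ℕ.*-assoc (2 ℕ.^ (4 ℕ.+ g)) k n) (cong (2 ℕ.^ (4 ℕ.+ g) ℕ.*_) (ℕ.*-comm k n))) (ℕ.*-identityʳ u)
        (fraction-≤⁻ 1 n (ℚᵘ.≤-trans (ℚᵘ.≤-reflexive (ℚᵘ.≃-sym (fraction-*-int (2 ℕ.^ (4 ℕ.+ g)) k))) dense))

      dense-at : ∀ {b} → b ℕ.< 4 ℕ.+ g → 2 ℕ.^ b ℕ.* (n ℕ.* k) ℕ.< u
      dense-at b< = ℕ.<-≤-trans (ℕ.*-monoˡ-< (n ℕ.* k) (ℕ.^-monoʳ-< 2 (ℕ.s≤s (ℕ.s≤s ℕ.z≤n)) b<)) dense′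

      -- `s` is the integer part of the logarithm of `x` minus `g`: the constant loss is removed
      -- before rounding.
      log : ∃[ s ] 2 ℕ.^ s ℕ.* (2 ℕ.^ g ℕ.* (n ℕ.* k)) ℕ.≤ u × u ℕ.< 2 ℕ.^ suc s ℕ.* (2 ℕ.^ g ℕ.* (n ℕ.* k))
      log = log₂-floor u (2 ℕ.^ g ℕ.* (n ℕ.* k)) (ℕ.>-nonZero⁻¹ _ {{ℕ.m*n≢0 (2 ℕ.^ g) (n ℕ.* k) {{ℕ.m^n≢0 2 g}}}})
              (ℕ.<⇒≤ (dense-at (ℕ.m<n+m g (ℕ.s≤s ℕ.z≤n))))

      s = proj₁ log

      u<2^ : u ℕ.< 2 ℕ.^ suc (s ℕ.+ g) ℕ.* (n ℕ.* k)
      u<2^ = subst (u ℕ.<_) (trans (sym (ℕ.*-assoc (2 ℕ.^ suc s) (2 ℕ.^ g) _))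
               (cong (ℕ._* (n ℕ.* k)) (sym (ℕ.^-distribˡ-+-* 2 (suc s) g)))) (proj₂ (proj₂ log))

      fromPositive : ∀ {m} → ∃[ m′ ] m ≡ + suc m′ × n ℕ.≤ 2 ℕ.^ (suc m′ ℕ.* s) →
                     ∃[ a ] (+ a ℤ.≤ + 6 ℤ.* m ℤ.+ + 6) × (∀ i → i ℕ.< k → ContainsLinearCycle G (a ℕ.+ i))
      fromPositive (m′ , refl , n≤) = proj₁ found , subst (+ proj₁ found ℤ.≤_)
        (trans (ℤ.pos-+ (6 ℕ.* suc m′) 6) (cong (ℤ._+ + 6) (ℤ.pos-* 6 (suc m′)))) (ℤ.+≤+ (proj₁ (proj₂ found))) , proj₂ (proj₂ found)
        where
        found = cyclesBelow r≥3 G linear k (suc m′) s (ℕ.>-nonZero⁻¹ k) (ℕ.s≤s ℕ.z≤n) n≤ (proj₁ (proj₂ log))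

    positiveLog : Positive (log₂ x - fromℚ (+ (2 ℕ.+ g) / 1))
    positiveLog = positive x u (n ℕ.* k) g x≃ (dense-at (ℕ.n<1+n (3 ℕ.+ g)))

    cyclesUpTo : ∀ m → m ≡⌈ log₂ (+ n / 1) ÷ (log₂ x - fromℚ (+ (2 ℕ.+ g) / 1)) [ positiveLog ] ⌉ →
                 ∃[ a ] (+ a ℤ.≤ + 6 ℤ.* m ℤ.+ + 6) × (∀ i → i ℕ.< k → ContainsLinearCycle G (a ℕ.+ i))
    cyclesUpTo m (_ , not) = fromPositive (ceiling-pos x u (n ℕ.* k) g x≃ positiveLog s {m} u<2^
      (edge⇒1<n r≥3 G (ℕ.≤-<-trans ℕ.z≤n (dense-at (ℕ.s≤s ℕ.z≤n)))) not)

open import Defs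
open import Data.Integer.Base as ℤ using (ℤ; +_)
open import Data.Nat.Base as ℕ using (ℕ; NonZero)
open import Data.Product.Base using (Σ-syntax; ∃-syntax; _×_)
open import Data.Rational.Unnormalised.Base using (ℚᵘ; _≤_; _*_; _/_)

theorem1p5 : ∀ (r : ℕ) → 3 ℕ.≤ r →
    Σ[ c₁ ∈ ℚᵘ ] Σ[ c₂ ∈ ℚᵘ ]
    (∀ (k : ℕ) .{{_ : NonZero k}} (n : ℕ) .{{_ : NonZero n}} (G : RGraph r n) →
    Linear G →
    c₁ * (+ k / 1) ≤ avgDegree G →
    Σ[ pos ∈ Positive (log₂ (avgDegree G * (+ 1 / k)) - fromℚ c₂) ]
    (∀ (m : ℤ) →
    m ≡⌈ log₂ (+ n / 1) ÷ (log₂ (avgDegree G * (+ 1 / k)) - fromℚ c₂) [ pos ] ⌉ →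
    ∃[ a ] (+ a ℤ.≤ + 6 ℤ.* m ℤ.+ + 6)
    × (∀ i → i ℕ.< k → ContainsLinearCycle G (a ℕ.+ i))))
-- `positive` needs `d / k` strictly above `2 ^ (3 + g)`, where `g` is `logSpread r`; the exponent
-- `4 + g` gets this from the non-strict hypothesis.
theorem1p5 r r≥3 = + (2 ℕ.^ (4 ℕ.+ logSpread r)) / 1 , + (2 ℕ.+ logSpread r) / 1 , λ k n G linear dense →
  positiveLog r≥3 G linear dense , cyclesUpTo r≥3 G linear dense
  where
  open import Data.Product.Base using (_,_)
  open Combinatorics using (logSpread)
  open Logarithms using (positiveLog; cyclesUpTo)
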